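{- Let $Q(n)$ be the number of $n$-quasigroups of order $4$ on the set $A=\{0,1,2,3\}$. Then for every natural number $n\ge 1$, $$Q(n) \leq 4 \cdot 6^n \cdot 4^{2^n - n - 1},$$ and the right-hand side equals $2^{2^{n+1} + O(n)}$ as $n\to\infty$.
   Context: Let $A=\{0,1,2,3\}$. For a natural number $n$, an $n$-quasigroup (of order $4$) is a pair $(A,q)$ where $q:A^n\to A$ satisfies $q(c)\neq q(c')$ for all $c,c'\in A^n$ that differ in exactly one coordinate. $Q(n)$ denotes the number of different $n$-quasigroups $(A,q)$, i.e. the number of such maps $q$ (not up to equivalence). -}

module Defs where

open import Data.Fin.Base using (Fin; zero; suc; combine; funToFin; finToFun)
import Data.Fin.Properties as Fin
open import Data.List.Base as List using (List; allFin; filter; length; map)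
open import Data.List.Membership.Propositional.Properties using (∈-allFin; ∈-lookup)
import Data.List.Membership.Setoid as SetoidMembership
import Data.List.Membership.Setoid.Properties as ∈ₚ
import Data.List.Relation.Unary.All as All
open import Data.List.Relation.Unary.All.Properties using (all-filter)
open import Data.List.Relation.Unary.AllPairs using (_∷_)
open import Data.List.Relation.Unary.Any using (index)
open import Data.List.Relation.Unary.Any.Properties using (lookup-index)
open import Data.List.Relation.Unary.Unique.Propositional.Properties using (allFin⁺)
open import Data.List.Relation.Unary.Unique.Setoid using (Unique)
import Data.List.Relation.Unary.Unique.Setoid.Properties as Uniqueₚ
open import Data.Nat.Base using (ℕ; zero; suc; _+_; _*_; _^_; _≤_; _≥_)
open import Data.Product.Base using (_×_; _,_; ∃-syntax)
open import Data.Vec.Base using (Vec; []; _∷_; lookup; tabulate)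
open import Data.Vec.Properties using (tabulate∘lookup; lookup∘tabulate; tabulate-cong)
open import Function.Base using (_∘_)
open import Function.Bundles using (Inverse)
open import Level using (0ℓ)
open import Relation.Binary.Bundles using (Setoid)
open import Relation.Binary.PropositionalEquality
  using (_≡_; _≢_; _≗_; refl; sym; trans; cong; cong₂; subst; setoid; _→-setoid_)
open import Relation.Nullary using (Dec; contradiction)
open import Relation.Nullary.Decidable using (map′; ¬?; _×-dec_; _→-dec_)
open import Relation.Unary using (Pred; Decidable)

A : Set
A = Fin 4

DifferInExactlyOne : ∀ {n} → Vec A n → Vec A n → Set
DifferInExactlyOne c c′ =
  ∃[ i ] (lookup c i ≢ lookup c′ i × (∀ j → j ≢ i → lookup c j ≡ lookup c′ j))

IsQuasigroup : ∀ n → (Vec A n → A) → Set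
IsQuasigroup n q = ∀ c c′ → DifferInExactlyOne c c′ → q c ≢ q c′

record Quasigroup (n : ℕ) : Set where
  constructor mkQuasigroup
  field
    op           : Vec A n → A
    isQuasigroup : IsQuasigroup n op

open Quasigroup public

-- Two quasigroups are the same when their operations agree at every tuple;
-- no isotopy or other equivalence is factored out.
quasigroupSetoid : ℕ → Setoid 0ℓ 0ℓ
quasigroupSetoid n = record
  { Carrier       = Quasigroup n
  ; _≈_           = λ p q → op p ≗ op q
  ; isEquivalence = record
    { refl  = λ _ → refl
    ; sym   = λ e c → sym (e c)
    ; trans = λ e f c → trans (e c) (f c)
    }
  }

differInExactlyOne? : ∀ {n} (c c′ : Vec A n) → Dec (DifferInExactlyOne c c′)
differInExactlyOne? c c′ = Fin.any? λ i →
  ¬? (lookup c i Fin.≟ lookup c′ i) ×-dec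
  Fin.all? (λ j → ¬? (j Fin.≟ i) →-dec (lookup c j Fin.≟ lookup c′ j))

allVec? : ∀ {n} {P : Pred (Vec A n) 0ℓ} → Decidable P → Dec (∀ c → P c)
allVec? {zero}  P? = map′ (λ { p [] → p }) (λ f → f []) (P? [])
allVec? {suc n} P? = map′ (λ { f (a ∷ c) → f a c }) (λ f a c → f (a ∷ c))
  (Fin.all? λ a → allVec? λ c → P? (a ∷ c))

isQuasigroup? : ∀ n → Decidable (IsQuasigroup n)
isQuasigroup? n q = allVec? λ c → allVec? λ c′ →
  differInExactlyOne? c c′ →-dec ¬? (q c Fin.≟ q c′)

encode : ∀ {n} → Vec A n → Fin (4 ^ n)
encode c = funToFin (lookup c)

-- The value table of a map Aⁿ → A, read as the base-4 digits of a code.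
decodeMap : ∀ n → Fin (4 ^ (4 ^ n)) → (Vec A n → A)
decodeMap n k c = finToFun {4} {4 ^ n} k (encode c)

-- Every map Aⁿ → A, exactly once up to pointwise equality
-- (see ∈-allMaps and allMaps-unique).
allMaps : ∀ n → List (Vec A n → A)
allMaps n = map (decodeMap n) (allFin (4 ^ (4 ^ n)))

Q : ℕ → ℕ
Q n = length (filter (isQuasigroup? n) (allMaps n))

-- f(n) = 2^(e(n) + O(g(n))) as n → ∞, i.e. |log₂ f(n) − e(n)| ≤ C g(n) for all
-- large n, with both inequalities exponentiated and the subtraction moved to the
-- other side.  A real constant C may be rounded up, so C : ℕ loses nothing.
_=2^⟨_+O⟨_⟩⟩ : (f e g : ℕ → ℕ) → Set
f =2^⟨ e +O⟨ g ⟩⟩ = ∃[ C ] ∃[ n₀ ] (∀ n → n ≥ n₀ →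
  (2 ^ e n ≤ f n * 2 ^ (C * g n)) × (f n ≤ 2 ^ (e n + C * g n)))

------------------------------------------------------------------------
-- Q n is the cardinality of quasigroupSetoid n.

funToFin-cong : ∀ {m k} {f g : Fin m → Fin k} → f ≗ g → funToFin f ≡ funToFin g
funToFin-cong {zero}  e = refl
funToFin-cong {suc m} e = cong₂ combine (e zero) (funToFin-cong (e ∘ suc))

decode : ∀ n → Fin (4 ^ n) → Vec A n
decode n k = tabulate (finToFun {4} {n} k)

encode-decode : ∀ n k → encode (decode n k) ≡ k
encode-decode n k = trans
  (funToFin-cong (lookup∘tabulate (finToFun {4} {n} k)))
  (Fin.funToFin-finToFin {n} {4} k)

decode-encode : ∀ {n} (c : Vec A n) → decode n (encode c) ≡ c
decode-encode c = trans
  (tabulate-cong (Fin.finToFun-funToFin (lookup c))) (tabulate∘lookup c)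

decodeMap-injective : ∀ n {k l} → decodeMap n k ≗ decodeMap n l → k ≡ l
decodeMap-injective n {k} {l} e = trans (sym (Fin.funToFin-finToFin {4 ^ n} {4} k))
  (trans (funToFin-cong same) (Fin.funToFin-finToFin {4 ^ n} {4} l))
  where
  same : finToFun {4} {4 ^ n} k ≗ finToFun {4} {4 ^ n} l
  same j = subst (λ i → finToFun {4} {4 ^ n} k i ≡ finToFun {4} {4 ^ n} l i)
    (encode-decode n j) (e (decode n j))

mapSetoid : ℕ → Setoid 0ℓ 0ℓ
mapSetoid n = Vec A n →-setoid A

open module Mem {n} = SetoidMembership (mapSetoid n) using (_∈_)

∈-allMaps : ∀ n (q : Vec A n → A) → q ∈ allMaps n
∈-allMaps n q = ∈ₚ.∈-resp-≈ (mapSetoid n) code-correct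
  (∈ₚ.∈-map⁺ (setoid _) (mapSetoid n) (λ { refl _ → refl }) (∈-allFin code))
  where
  code : Fin (4 ^ (4 ^ n))
  code = funToFin (q ∘ decode n)

  code-correct : decodeMap n code ≗ q
  code-correct c = trans (Fin.finToFun-funToFin (q ∘ decode n) (encode c))
    (cong q (decode-encode c))

allMaps-unique : ∀ n → Unique (mapSetoid n) (allMaps n)
allMaps-unique n = Uniqueₚ.map⁺ (setoid _) (mapSetoid n)
  (decodeMap-injective n) (allFin⁺ (4 ^ (4 ^ n)))

isQuasigroup-resp : ∀ n {p q : Vec A n → A} → p ≗ q → IsQuasigroup n p → IsQuasigroup n q
isQuasigroup-resp n e P c c′ d = P c c′ d ∘ λ eq → trans (e c) (trans eq (sym (e c′)))

lookup-injective : ∀ (S : Setoid 0ℓ 0ℓ) {xs} → Unique S xs →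
                   ∀ i j → Setoid._≈_ S (List.lookup xs i) (List.lookup xs j) → i ≡ j
lookup-injective S (_ ∷ _)  zero    zero    _ = refl
lookup-injective S (x∉ ∷ _) zero    (suc j) e = contradiction e (All.lookup x∉ (∈-lookup j))
lookup-injective S (x∉ ∷ _) (suc i) zero    e =
  contradiction (Setoid.sym S e) (All.lookup x∉ (∈-lookup i))
lookup-injective S (_ ∷ u)  (suc i) (suc j) e = cong suc (lookup-injective S u i j e)

Q-counts : ∀ n → Inverse (quasigroupSetoid n) (setoid (Fin (Q n)))
Q-counts n = record
  { to        = to
  ; from      = from
  ; to-cong   = λ {p} {q} e → lookup-inj _ _ λ c →
      trans (sym (lookup-to p c)) (trans (e c) (lookup-to q c))
  ; from-cong = λ { refl _ → refl }
  ; inverse   = (λ {i} {q} e → lookup-inj _ _ λ c → trans (sym (lookup-to q c)) (e c))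
              , (λ { {q} refl c → sym (lookup-to q c) })
  }
  where
  qs : List (Vec A n → A)
  qs = filter (isQuasigroup? n) (allMaps n)

  ∈-qs : (q : Quasigroup n) → op q ∈ qs
  ∈-qs q = ∈ₚ.∈-filter⁺ (mapSetoid n) (isQuasigroup? n) (isQuasigroup-resp n)
    (∈-allMaps n (op q)) (isQuasigroup q)

  to : Quasigroup n → Fin (Q n)
  to q = index (∈-qs q)

  from : Fin (Q n) → Quasigroup n
  from i = mkQuasigroup (List.lookup qs i)
    (All.lookup (all-filter (isQuasigroup? n) (allMaps n)) (∈-lookup i))

  lookup-to : ∀ q → op q ≗ List.lookup qs (to q)
  lookup-to q = lookup-index (∈-qs q)

  lookup-inj : ∀ i j → List.lookup qs i ≗ List.lookup qs j → i ≡ j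
  lookup-inj = lookup-injective (mapSetoid n)
    (Uniqueₚ.filter⁺ (mapSetoid n) (isQuasigroup? n) (allMaps-unique n))

{-# OPTIONS --safe #-}
-- A quasigroup q is determined face by face: for S ⊆ {1 , … , n} let q_S be its restriction to
-- the points that are 0 outside S.  Given q_S on the points with a further zero coordinate there
-- are at most 4, 6 or 4 possibilities for q_S if |S| is 0, 1 or at least 2; the product over all
-- S is the bound.
--
-- For |S| ≥ 2 suppose that five extensions have the same boundary values.  By induction two of
-- them agree on the layer x₁ = 1 (if |S| = 2, because this layer is a row that avoids row 0 and is
-- therefore determined by its value at 0 and one further value).  If they differ, they differ by an exchange of the two layers
-- x₁ = 2 , 3 at some places; such a place spans a box of 2 × … × 2 places on which the
-- quasigroup takes only two values a , b, and then the indicator of {a , b} is, along the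
-- quasigroup, a sum mod 2 of functions of one coordinate each.  The same holds for x₁ = 2.
-- These two separations make the boundary values affine over ℤ₂², and a quasigroup with
-- affine boundary values is one of four: the affine one, or, for one of the three subgroups
-- {0 , t}, the affine one shifted by t on the cube (A ∖ {0 , t})ⁿ.
module Submission where

open import Defs
open import Data.Bool.Base using (Bool; true; false; not; _∨_; _xor_; if_then_else_)
import Data.Bool.Properties as Bool
open import Data.Fin.Base using (Fin; zero; suc; combine; punchOut)
open import Data.Fin.Patterns using (0F; 1F; 2F; 3F)
import Data.Fin.Properties as Fin
open import Data.Nat.Base using (ℕ; zero; suc; _+_; _*_; _∸_; _^_; _≤_; _≥_; s≤s; z≤n)
import Data.Nat.Properties as ℕ
open import Data.Nat.Solver using (module +-*-Solver)
open import Data.Product.Base using (Σ-syntax; _×_; _,_; ∃-syntax; proj₁; proj₂; map₂)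
open import Data.Sum.Base using (_⊎_; inj₁; inj₂)
open import Data.Vec.Base using (Vec; []; _∷_; lookup; tabulate; replicate; _[_]≔_)
open import Data.Vec.Properties using ([]≔-lookup; lookup∘update; lookup∘update′; lookup∘tabulate)
open import Function.Base using (_∘_; flip; case_of_)
open import Function.Bundles using (Inverse)
import Relation.Binary.Construct.On as On
open import Relation.Binary.PropositionalEquality
  using (_≡_; _≢_; _≗_; refl; sym; trans; cong; cong₂; subst; subst₂; ≢-sym; setoid; module ≡-Reasoning)
open import Relation.Binary.Structures using (IsDecEquivalence)
open import Relation.Nullary using (Dec; yes; no; does; contradiction)
open import Relation.Nullary.Decidable
  using (¬?; _×-dec_; _⊎-dec_; _→-dec_; from-yes; dec-true; dec-false; decidable-stable)
open +-*-Solver using (solve; _:*_; _:=_; con)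

-- Permutations of a four-element set

Injective : (A → A) → Set
Injective s = ∀ {a b} → s a ≡ s b → a ≡ b

Distinct₃ : A → A → A → Set
Distinct₃ a b c = a ≢ b × a ≢ c × b ≢ c

Distinct₄ : A → A → A → A → Set
Distinct₄ a b c d = a ≢ b × a ≢ c × a ≢ d × b ≢ c × b ≢ d × c ≢ d

_≢?_ : (a b : A) → Dec (a ≢ b)
a ≢? b = ¬? (a Fin.≟ b)

distinct₃? : ∀ a b c → Dec (Distinct₃ a b c)
distinct₃? a b c = a ≢? b ×-dec a ≢? c ×-dec b ≢? c

distinct₄? : ∀ a b c d → Dec (Distinct₄ a b c d)
distinct₄? a b c d =
  a ≢? b ×-dec a ≢? c ×-dec a ≢? d ×-dec b ≢? c ×-dec b ≢? d ×-dec c ≢? d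

abstract
  cover : ∀ a b c d → Distinct₄ a b c d → ∀ z → z ≡ a ⊎ z ≡ b ⊎ z ≡ c ⊎ z ≡ d
  cover = from-yes (Fin.all? λ a → Fin.all? λ b → Fin.all? λ c → Fin.all? λ d →
    distinct₄? a b c d →-dec Fin.all? λ z →
    (z Fin.≟ a) ⊎-dec (z Fin.≟ b) ⊎-dec (z Fin.≟ c) ⊎-dec (z Fin.≟ d))

  fourth : ∀ a b c → Distinct₃ a b c → ∃[ d ] Distinct₄ a b c d
  fourth = from-yes (Fin.all? λ a → Fin.all? λ b → Fin.all? λ c →
    distinct₃? a b c →-dec Fin.any? λ d → distinct₄? a b c d)

  otherTwo : ∀ a b → a ≢ b → ∃[ c ] ∃[ d ] Distinct₄ a b c d
  otherTwo = from-yes (Fin.all? λ a → Fin.all? λ b →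
    a ≢? b →-dec Fin.any? λ c → Fin.any? λ d → distinct₄? a b c d)

image-distinct₄ : ∀ {s} → Injective s → ∀ {a b c d} →
                  Distinct₄ a b c d → Distinct₄ (s a) (s b) (s c) (s d)
image-distinct₄ inj (ab , ac , ad , bc , bd , cd) =
  ab ∘ inj , ac ∘ inj , ad ∘ inj , bc ∘ inj , bd ∘ inj , cd ∘ inj

injective⇒surjective : ∀ {s} → Injective s → ∀ v → ∃[ y ] s y ≡ v
injective⇒surjective {s} inj v
  with cover (s 0F) (s 1F) (s 2F) (s 3F)
    (image-distinct₄ {s} inj (from-yes (distinct₄? 0F 1F 2F 3F))) v
... | inj₁ e               = 0F , sym e
... | inj₂ (inj₁ e)        = 1F , sym e
... | inj₂ (inj₂ (inj₁ e)) = 2F , sym e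
... | inj₂ (inj₂ (inj₂ e)) = 3F , sym e

-- Both permutations map {y , z} onto the complement of the same two values, so on y , z they either
-- agree or are exchanged.
module AgreeTwice {s t : A → A} (s-inj : Injective s) (t-inj : Injective t)
  {w x y z : A} (d : Distinct₄ w x y z) (ew : s w ≡ t w) (ex : s x ≡ t x) where

  agreeThrice : s y ≡ t y → s z ≡ t z
  agreeThrice ey with cover (s w) (s x) (s y) (s z) (image-distinct₄ {s} s-inj d) (t z)
  ... | inj₁ e               = contradiction (t-inj (trans (sym ew) (sym e))) (proj₁ (proj₂ (proj₂ d)))
  ... | inj₂ (inj₁ e)        = contradiction (t-inj (trans (sym ex) (sym e)))
                                 (proj₁ (proj₂ (proj₂ (proj₂ (proj₂ d)))))
  ... | inj₂ (inj₂ (inj₁ e)) = contradiction (t-inj (trans (sym ey) (sym e)))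
                                 (proj₂ (proj₂ (proj₂ (proj₂ (proj₂ d)))))
  ... | inj₂ (inj₂ (inj₂ e)) = sym e

  swapped : s y ≢ t y → t y ≡ s z
  swapped sy≢ty with cover (s w) (s x) (s y) (s z) (image-distinct₄ {s} s-inj d) (t y)
  ... | inj₁ e               = contradiction (t-inj (trans (sym ew) (sym e))) (proj₁ (proj₂ d))
  ... | inj₂ (inj₁ e)        = contradiction (t-inj (trans (sym ex) (sym e)))
                                 (proj₁ (proj₂ (proj₂ (proj₂ d))))
  ... | inj₂ (inj₂ (inj₁ e)) = contradiction (sym e) sy≢ty
  ... | inj₂ (inj₂ (inj₂ e)) = e

swapLast : ∀ {w x y z} → Distinct₄ w x y z → Distinct₄ w x z y
swapLast (wx , wy , wz , xy , xz , yz) = wx , wz , wy , xz , xy , ≢-sym yz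

-- Quasigroups, via injectivity on lines

-- Phrased with updates because `(a ∷ x) [ suc i ]≔ b` reduces to `a ∷ (x [ i ]≔ b)`: restricting to
-- a layer only shifts the index.
LineInjective : ∀ {n} → (Vec A n → A) → Set
LineInjective f = ∀ i x → Injective (λ a → f (x [ i ]≔ a))

isQuasigroup⇒lineInjective : ∀ {n f} → IsQuasigroup n f → LineInjective f
isQuasigroup⇒lineInjective {f = f} q i x {a} {b} e = decidable-stable (a Fin.≟ b) λ a≢b →
  q (x [ i ]≔ a) (x [ i ]≔ b)
    ( i
    , (λ e′ → a≢b (trans (sym (lookup∘update i x a)) (trans e′ (lookup∘update i x b))))
    , λ j j≢i → trans (lookup∘update′ j≢i x a) (sym (lookup∘update′ j≢i x b)))
    e

lineInjective⇒isQuasigroup : ∀ {n f} → LineInjective f → IsQuasigroup n f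
lineInjective⇒isQuasigroup {f = f} inj c c′ (i , cᵢ≢c′ᵢ , same) e =
  cᵢ≢c′ᵢ (inj i c (trans (cong f ([]≔-lookup c i)) (trans e (cong f (replaced c c′ i same)))))
  where
  replaced : ∀ {n} (c c′ : Vec A n) i → (∀ j → j ≢ i → lookup c j ≡ lookup c′ j) →
             c′ ≡ c [ i ]≔ lookup c′ i
  replaced (a ∷ c) (b ∷ c′) zero s = cong (b ∷_) (extensional c′ c λ j → sym (s (suc j) λ ()))
    where
    extensional : ∀ {n} (x y : Vec A n) → (∀ j → lookup x j ≡ lookup y j) → x ≡ y
    extensional []      []      _ = refl
    extensional (_ ∷ x) (_ ∷ y) s = cong₂ _∷_ (s zero) (extensional x y (s ∘ suc))
  replaced (a ∷ c) (b ∷ c′) (suc i) s =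
    cong₂ _∷_ (sym (s zero λ ())) (replaced c c′ i λ j j≢i → s (suc j) (j≢i ∘ Fin.suc-injective))

HasZero : ∀ {n} → Vec A n → Set
HasZero x = ∃[ i ] lookup x i ≡ zero

infix 4 _≈₀_
_≈₀_ : ∀ {n} → (Vec A n → A) → (Vec A n → A) → Set
f ≈₀ g = ∀ x → HasZero x → f x ≡ g x

≈₀-layer : ∀ {n} {f g : Vec A (suc n) → A} → f ≈₀ g → ∀ a → f ∘ (a ∷_) ≈₀ g ∘ (a ∷_)
≈₀-layer e a x (i , z) = e (a ∷ x) (suc i , z)

-- Switched layers: for two quasigroups f, g that agree on two parallel layers,
-- a cell records the values of f and of g on the two other ones.

record Cell : Set where
  constructor cell
  field u w u′ w′ : A

open Cell

Swapped Fixed : Cell → Set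
Swapped c = u′ c ≡ w c × w′ c ≡ u c
Fixed   c = u′ c ≡ u c × w′ c ≡ w c

Mate : Cell → Cell → Set
Mate c d = Swapped d × u d ≡ w c × w d ≡ u c

record SwitchLine (k : A → Cell) : Set where
  field
    u-inj  : Injective (u ∘ k)
    w-inj  : Injective (w ∘ k)
    u′-inj : Injective (u′ ∘ k)
    u≢w    : ∀ y → u (k y) ≢ w (k y)
    either : ∀ y → Swapped (k y) ⊎ Fixed (k y)
    fixed₀ : Fixed (k zero)

  swapped⇒≢0 : ∀ {p} → Swapped (k p) → p ≢ zero
  swapped⇒≢0 {p} (e , _) refl = u≢w p (trans (sym (proj₁ fixed₀)) e)

  -- A line with a swapped cell has exactly two. If there were only one, `u` and `u′` would agree at
  -- three places and hence at `p`; if there were three, `u′` and `w` would agree at three places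
  -- and hence at 0. With one further fixed place besides 0, `u` and `u′` exchange their values at
  -- the two swapped cells.
  mate : ∀ p → Swapped (k p) → ∃[ q ] Mate (k p) (k q)
  mate p sp with otherTwo zero p (≢-sym (swapped⇒≢0 sp))
  ... | y , z , d@(0p , 0y , 0z , py , pz , yz) with either y | either z
  ... | inj₂ fy | inj₂ fz = contradiction
    (trans (AgreeTwice.agreeThrice u-inj u′-inj (0y , 0z , 0p , yz , ≢-sym py , ≢-sym pz)
      (sym (proj₁ fixed₀)) (sym (proj₁ fy)) (sym (proj₁ fz))) (proj₁ sp))
    (u≢w p)
  ... | inj₁ sy | inj₂ fz = y , sy ,
      trans (sym (M.swapped up≢u′p)) (proj₁ sp) ,
      trans (sym (proj₁ sy)) (M′.swapped uy≢u′y)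
    where
    module M  = AgreeTwice u-inj u′-inj {y = p} {z = y}
      (0z , 0p , 0y , ≢-sym pz , ≢-sym yz , py) (sym (proj₁ fixed₀)) (sym (proj₁ fz))
    module M′ = AgreeTwice u-inj u′-inj {y = y} {z = p}
      (0z , 0y , 0p , ≢-sym yz , ≢-sym pz , ≢-sym py) (sym (proj₁ fixed₀)) (sym (proj₁ fz))
    up≢u′p : u (k p) ≢ u′ (k p)
    up≢u′p e = u≢w p (trans e (proj₁ sp))
    uy≢u′y : u (k y) ≢ u′ (k y)
    uy≢u′y e = u≢w y (trans e (proj₁ sy))
  ... | inj₂ fy | inj₁ sz = z , sz ,
      trans (sym (M.swapped up≢u′p)) (proj₁ sp) ,
      trans (sym (proj₁ sz)) (M′.swapped uz≢u′z)
    where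
    module M  = AgreeTwice u-inj u′-inj {y = p} {z = z}
      (0y , 0p , 0z , ≢-sym py , yz , pz) (sym (proj₁ fixed₀)) (sym (proj₁ fy))
    module M′ = AgreeTwice u-inj u′-inj {y = z} {z = p}
      (0y , 0z , 0p , yz , ≢-sym py , ≢-sym pz) (sym (proj₁ fixed₀)) (sym (proj₁ fy))
    up≢u′p : u (k p) ≢ u′ (k p)
    up≢u′p e = u≢w p (trans e (proj₁ sp))
    uz≢u′z : u (k z) ≢ u′ (k z)
    uz≢u′z e = u≢w z (trans e (proj₁ sz))
  -- If all three nonzero places were swapped, u and w would also agree at 0.
  ... | inj₁ sy | inj₁ sz = contradiction
    (trans (sym (proj₁ fixed₀)) (AgreeTwice.agreeThrice u′-inj w-inj
      (py , pz , ≢-sym 0p , yz , ≢-sym 0y , ≢-sym 0z)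
      (proj₁ sp) (proj₁ sy) (proj₁ sz)))
    (u≢w zero)

open SwitchLine

module Plane (k : A → A → Cell) (rows : ∀ y → SwitchLine (k y))
             (cols : ∀ z → SwitchLine (flip k z)) where

  -- The cell at (p , r) has a mate in its column, in some row v′, and the cell at (v , q) has a
  -- mate in its row, in some column r′. If either of these is the corner (v , r), the values
  -- follow; the remaining case is contradictory.
  fourthCorner : ∀ {p q v r} → Swapped (k p q) → Mate (k p q) (k v q) → Mate (k p q) (k p r) →
                 Mate (k v q) (k v r)
  fourthCorner {p} {q} {v} {r} sp (sv , uv , wv) (sr , ur , wr)
    with mate (cols r) p sr | mate (rows v) q sv
  ... | v′ , sv′ , uv′ , wv′ | r′ , sr′ , ur′ , wr′ with v′ Fin.≟ v | r′ Fin.≟ r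
  ... | yes refl | _        = sv′ , trans uv′ (trans wr (sym wv)) , trans wv′ (trans ur (sym uv))
  ... | no _     | yes refl = sr′ , ur′ , wr′
  -- Otherwise the rows p, v, v′ each contain both values {a , b} = {u , w} (k p q)
  -- off column 0, and column 0 would have three entries in the complement of {a , b}.
  ... | no v′≢v  | no r′≢r
    with mate (rows v′) r sv′
  ... | r″ , sr″ , ur″ , wr″ = contradiction
    (cover (u (k p zero)) (u (k v zero)) (u (k p q)) (w (k p q))
      ( p≢v ∘ u-inj (cols zero) , avoid-a p q refl sp , avoid-b p r ur sr
      , avoid-a v r′ (trans ur′ wv) sr′ , avoid-b v q uv sv , u≢w (rows p) q)
      (u (k v′ zero)))
    λ { (inj₁ e)               → p≢v′ (sym (u-inj (cols zero) e))
      ; (inj₂ (inj₁ e))        → v′≢v (u-inj (cols zero) e)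
      ; (inj₂ (inj₂ (inj₁ e))) → avoid-a v′ r (trans uv′ wr) sv′ e
      ; (inj₂ (inj₂ (inj₂ e))) → avoid-b v′ r″ (trans ur″ (trans wv′ ur)) sr″ e }
    where
    avoid-a : ∀ y z → u (k y z) ≡ u (k p q) → Swapped (k y z) → u (k y zero) ≢ u (k p q)
    avoid-a y z e s e′ = swapped⇒≢0 (rows y) s (u-inj (rows y) (trans e (sym e′)))
    avoid-b : ∀ y z → u (k y z) ≡ w (k p q) → Swapped (k y z) → u (k y zero) ≢ w (k p q)
    avoid-b y z e s e′ = swapped⇒≢0 (rows y) s (u-inj (rows y) (trans e (sym e′)))
    p≢v : p ≢ v
    p≢v refl = u≢w (rows p) q uv
    p≢v′ : p ≢ v′
    p≢v′ refl = u≢w (rows p) r uv′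

-- Boxes of swapped cells

data Box : ∀ {n} → Vec A n → Vec A n → Vec A n → Set where
  []   : Box [] [] []
  left  : ∀ {n a b} {p q x : Vec A n} → Box p q x → Box (a ∷ p) (b ∷ q) (a ∷ x)
  right : ∀ {n a b} {p q x : Vec A n} → Box p q x → Box (a ∷ p) (b ∷ q) (b ∷ x)

SamePair : Cell → Cell → Set
SamePair c d = (u d ≡ u c × w d ≡ w c) ⊎ (u d ≡ w c × w d ≡ u c)

-- Induction on the dimension. Moving the head from `a` to `b` replaces the base cell by its mate,
-- which exchanges the two values; `fourthCorner`, in the plane of the head and coordinate i,
-- carries the mates of the old base cell over to the new one.
switchBox : ∀ {n} (k : Vec A n → Cell) → (∀ i x → SwitchLine (λ y → k (x [ i ]≔ y))) →
      ∀ p q → Swapped (k p) → (∀ i → Mate (k p) (k (p [ i ]≔ lookup q i))) →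
      ∀ {x} → Box p q x → SamePair (k p) (k x)
switchBox k lines []       []       sp mates []         = inj₁ (refl , refl)
switchBox k lines (a ∷ p)  (b ∷ q)  sp mates (left x∈)  =
  switchBox (k ∘ (a ∷_)) (λ i x → lines (suc i) (a ∷ x)) p q sp (λ i → mates (suc i)) x∈
switchBox k lines (a ∷ p)  (b ∷ q)  sp mates (right {x = x} x∈) = flipPair (k (b ∷ x))
  (switchBox (k ∘ (b ∷_)) (λ i x → lines (suc i) (b ∷ x)) p q (proj₁ (mates zero)) mates′ x∈)
  where
  mates′ : ∀ i → Mate (k (b ∷ p)) (k (b ∷ (p [ i ]≔ lookup q i)))
  mates′ i = subst (λ p′ → Mate (k (b ∷ p′)) (k (b ∷ (p [ i ]≔ lookup q i)))) unchanged
    (Plane.fourthCorner (λ y z → k (y ∷ (p [ i ]≔ z)))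
      (λ y → lines (suc i) (y ∷ p)) (λ z → lines zero (a ∷ (p [ i ]≔ z)))
      {a} {lookup p i} {b} {lookup q i}
      (subst (λ p′ → Swapped (k (a ∷ p′))) (sym unchanged) sp)
      (subst (λ p′ → Mate (k (a ∷ p′)) (k (b ∷ p′))) (sym unchanged) (mates zero))
      (subst (λ p′ → Mate (k (a ∷ p′)) (k (a ∷ (p [ i ]≔ lookup q i)))) (sym unchanged)
        (mates (suc i))))
    where
    unchanged : p [ i ]≔ lookup p i ≡ p
    unchanged = []≔-lookup p i
  flipPair : ∀ d → SamePair (k (b ∷ p)) d → SamePair (k (a ∷ p)) d
  flipPair _ (inj₁ (e , e′)) = inj₂ (trans e (proj₁ (proj₂ (mates zero))) , trans e′ (proj₂ (proj₂ (mates zero))))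
  flipPair _ (inj₂ (e , e′)) = inj₁ (trans e (proj₂ (proj₂ (mates zero))) , trans e′ (proj₁ (proj₂ (mates zero))))

-- Separable maps to Bool

pair? : A → A → A → Bool
pair? a b v = does (v Fin.≟ a) ∨ does (v Fin.≟ b)

pair?-left : ∀ a b → pair? a b a ≡ true
pair?-left a b rewrite dec-true (a Fin.≟ a) refl = refl

pair?-right : ∀ a b → pair? a b b ≡ true
pair?-right a b rewrite dec-true (b Fin.≟ b) refl = Bool.∨-zeroʳ _

pair?-outside : ∀ {a b v} → v ≢ a → v ≢ b → pair? a b v ≡ false
pair?-outside {a} {b} {v} v≢a v≢b
  rewrite dec-false (v Fin.≟ a) v≢a | dec-false (v Fin.≟ b) v≢b = refl

-- On four points this means that each truth value is taken exactly twice.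
Balanced : (A → Bool) → Set
Balanced χ = ∀ a b c → Distinct₃ a b c → χ a ≡ χ b → χ c ≡ not (χ a)

abstract
  pair?-balanced : ∀ a b → a ≢ b → Balanced (pair? a b)
  pair?-balanced = from-yes (Fin.all? λ a → Fin.all? λ b → a ≢? b →-dec
    Fin.all? λ x → Fin.all? λ y → Fin.all? λ z → distinct₃? x y z →-dec
    (pair? a b x Bool.≟ pair? a b y →-dec pair? a b z Bool.≟ not (pair? a b x)))

parity : ∀ {n} → (Fin n → A → Bool) → Vec A n → Bool
parity β []      = false
parity β (a ∷ x) = β zero a xor parity (β ∘ suc) x

inPair : ∀ {n} → Vec A n → Vec A n → Fin n → A → Bool
inPair p q i = pair? (lookup p i) (lookup q i)

-- `parity (inPair p q)` counts the coordinates inside the box, whereas a map constant on the box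
-- changes with each coordinate outside; the n negations make up the difference.
flips : ℕ → Bool → Bool
flips zero    s = s
flips (suc n) s = not (flips n s)

xor-not-not : ∀ s t → not s xor not t ≡ s xor t
xor-not-not false t = Bool.not-involutive t
xor-not-not true  t = refl

-- On every line the two places outside the box carry the opposite of the common
-- value at the two places inside.
box⇒separable : ∀ {n} (h : Vec A n → Bool) → (∀ i x → Balanced (λ y → h (x [ i ]≔ y))) →
                ∀ p q → (∀ i → lookup p i ≢ lookup q i) →
                ∀ s → (∀ {x} → Box p q x → h x ≡ s) →
                ∀ x → h x ≡ flips n s xor parity (inPair p q) x
box⇒separable h bal [] [] p≢q s in-box [] = trans (in-box []) (sym (Bool.xor-identityʳ s))
box⇒separable {suc n} h bal (a ∷ p) (b ∷ q) p≢q s in-box (y ∷ x) = head-case (y Fin.≟ a) (y Fin.≟ b)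
  where
  r : Bool
  r = parity (inPair p q) x
  layer : ∀ c → (∀ {x} → Box p q x → Box (a ∷ p) (b ∷ q) (c ∷ x)) → h (c ∷ x) ≡ flips n s xor r
  layer c inside = box⇒separable (h ∘ (c ∷_)) (λ i x → bal (suc i) (c ∷ x)) p q (p≢q ∘ suc)
    s (in-box ∘ inside) x
  inner : ∀ {c} → pair? a b c ≡ true → h (c ∷ x) ≡ flips n s xor r →
          h (c ∷ x) ≡ not (flips n s) xor (pair? a b c xor r)
  inner e hc rewrite e = trans hc (sym (xor-not-not (flips n s) r))
  head-case : Dec (y ≡ a) → Dec (y ≡ b) →
              h (y ∷ x) ≡ not (flips n s) xor (pair? a b y xor r)
  head-case (yes refl) _          = inner (pair?-left a b) (layer a left)
  head-case (no _)     (yes refl) = inner (pair?-right a b) (layer b right)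
  head-case (no y≢a)   (no y≢b)   rewrite pair?-outside y≢a y≢b = begin
    h (y ∷ x)             ≡⟨ bal zero (y ∷ x) a b y (p≢q zero , ≢-sym y≢a , ≢-sym y≢b)
                               (trans (layer a left) (sym (layer b right))) ⟩
    not (h (a ∷ x))       ≡⟨ cong not (layer a left) ⟩
    not (flips n s xor r) ≡⟨ Bool.not-distribˡ-xor (flips n s) r ⟩
    not (flips n s) xor r ∎
    where open ≡-Reasoning

-- From an exchange of layers to a separation

-- χ ∘ f is a sum of functions of one coordinate each; the head coordinate is split
-- into {0 , c} and its complement.
record Separation {n} (f : Vec A (suc n) → A) (c : A) : Set where
  field
    χ         : A → Bool
    β         : Fin (suc n) → A → Bool
    separates : ∀ x → χ (f x) ≡ parity β x
    β-zero    : ∀ i → β i zero ≡ false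
    β-c       : β zero c ≡ false
    β-other   : ∀ y → y ≢ zero → y ≢ c → β zero y ≡ true

-- On each line in the head direction `f` and `g` agree at 0 and `c`, so at `j` and `k` they agree
-- or are exchanged. Hence `cells` gives a `SwitchLine` in every direction, and a differing point
-- gives a swapped cell at which a box can start.
module Switch {n} {f g : Vec A (suc n) → A}
  (f-inj : LineInjective f) (g-inj : LineInjective g) (f≈g : f ≈₀ g)
  {c j k : A} (d : Distinct₄ zero c j k) (same : ∀ x → f (c ∷ x) ≡ g (c ∷ x))
  (p : Vec A n) (differ : f (j ∷ p) ≢ g (j ∷ p)) where

  cells : Vec A n → Cell
  cells x = cell (f (j ∷ x)) (f (k ∷ x)) (g (j ∷ x)) (g (k ∷ x))

  j≢k : j ≢ k
  j≢k = proj₂ (proj₂ (proj₂ (proj₂ (proj₂ d))))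

  swap-at : ∀ x → f (j ∷ x) ≢ g (j ∷ x) → Swapped (cells x)
  swap-at x ne = J.swapped ne , K.swapped λ e → ne (K.agreeThrice e)
    where
    module J = AgreeTwice (f-inj zero (j ∷ x)) (g-inj zero (j ∷ x)) d
      (f≈g (zero ∷ x) (zero , refl)) (same x)
    module K = AgreeTwice (f-inj zero (j ∷ x)) (g-inj zero (j ∷ x)) (swapLast d)
      (f≈g (zero ∷ x) (zero , refl)) (same x)

  fixed-at : ∀ x → f (j ∷ x) ≡ g (j ∷ x) → Fixed (cells x)
  fixed-at x e = sym e , sym (AgreeTwice.agreeThrice (f-inj zero (j ∷ x)) (g-inj zero (j ∷ x)) d
    (f≈g (zero ∷ x) (zero , refl)) (same x) e)

  lines : ∀ i x → SwitchLine (λ y → cells (x [ i ]≔ y))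
  lines i x = record
    { u-inj  = f-inj (suc i) (j ∷ x)
    ; w-inj  = f-inj (suc i) (k ∷ x)
    ; u′-inj = g-inj (suc i) (j ∷ x)
    ; u≢w    = λ y e → j≢k (f-inj zero (j ∷ (x [ i ]≔ y)) e)
    ; either = λ y → case f (j ∷ (x [ i ]≔ y)) Fin.≟ g (j ∷ (x [ i ]≔ y)) of λ
        { (yes e) → inj₂ (fixed-at _ e) ; (no ne) → inj₁ (swap-at _ ne) }
    ; fixed₀ = fixed-at _ (f≈g (j ∷ (x [ i ]≔ zero)) (suc i , lookup∘update i x zero))
    }

  a b : A
  a = f (j ∷ p)
  b = f (k ∷ p)

  a≢b : a ≢ b
  a≢b e = j≢k (f-inj zero (j ∷ p) e)

  swapped-p : Swapped (cells p)
  swapped-p = swap-at p differ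

  unchanged : ∀ i → p [ i ]≔ lookup p i ≡ p
  unchanged i = []≔-lookup p i

  swapped-p′ : ∀ i → Swapped (cells (p [ i ]≔ lookup p i))
  swapped-p′ i = subst (Swapped ∘ cells) (sym (unchanged i)) swapped-p

  mateOf : ∀ i → ∃[ y ] Mate (cells (p [ i ]≔ lookup p i)) (cells (p [ i ]≔ y))
  mateOf i = mate (lines i p) (lookup p i) (swapped-p′ i)

  -- The corner of the box opposite to `p`: coordinate i is where the mate of `p` lies on the line
  -- through `p` in direction i.
  q : Vec A n
  q = tabulate (proj₁ ∘ mateOf)

  mates : ∀ i → Mate (cells p) (cells (p [ i ]≔ lookup q i))
  mates i = subst₂ (λ p′ y → Mate (cells p′) (cells (p [ i ]≔ y)))
    (unchanged i) (sym (lookup∘tabulate (proj₁ ∘ mateOf) i)) (proj₂ (mateOf i))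

  p≢q : ∀ i → lookup p i ≢ lookup q i
  p≢q i e = a≢b (trans (cong (λ x → f (j ∷ x)) (sym (trans (cong (p [ i ]≔_) (sym e)) (unchanged i))))
    (proj₁ (proj₂ (mates i))))

  jp≢kq : ∀ i → lookup (j ∷ p) i ≢ lookup (k ∷ q) i
  jp≢kq zero    = j≢k
  jp≢kq (suc i) = p≢q i

  h : Vec A (suc n) → Bool
  h x = pair? a b (f x)

  h-balanced : ∀ i x → Balanced (λ y → h (x [ i ]≔ y))
  h-balanced i x y y′ y″ (ne , ne′ , ne″) =
    pair?-balanced a b a≢b _ _ _ (ne ∘ f-inj i x , ne′ ∘ f-inj i x , ne″ ∘ f-inj i x)

  h-box : ∀ {x} → Box (j ∷ p) (k ∷ q) x → h x ≡ true
  h-box (left x∈) with switchBox cells lines p q swapped-p mates x∈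
  ... | inj₁ (e , _) = trans (cong (pair? a b) e) (pair?-left a b)
  ... | inj₂ (e , _) = trans (cong (pair? a b) e) (pair?-right a b)
  h-box (right x∈) with switchBox cells lines p q swapped-p mates x∈
  ... | inj₁ (_ , e) = trans (cong (pair? a b) e) (pair?-right a b)
  ... | inj₂ (_ , e) = trans (cong (pair? a b) e) (pair?-left a b)

  s : Bool
  s = flips (suc n) true

  separation : Separation f c
  separation = record
    -- Adding the constant `s` cancels the constant that `box⇒separable` leaves.
    { χ         = λ v → s xor pair? a b v
    ; β         = inPair (j ∷ p) (k ∷ q)
    ; separates = λ x → trans
        (cong (s xor_) (box⇒separable h h-balanced (j ∷ p) (k ∷ q) jp≢kq true h-box x))
        (cancel s _)
    -- No coordinate of either corner is 0: a cell with a zero coordinate is fixed, while `p` and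
    -- its mates are swapped.
    ; β-zero    = λ
        { zero    → pair?-outside (proj₁ (proj₂ d)) (proj₁ (proj₂ (proj₂ d)))
        ; (suc i) → pair?-outside
            (≢-sym (swapped⇒≢0 (lines i p) (swapped-p′ i)))
            (≢-sym (swapped⇒≢0 (lines i p) (proj₁ (mates i)))) }
    ; β-c       = pair?-outside (proj₁ (proj₂ (proj₂ (proj₂ d)))) (proj₁ (proj₂ (proj₂ (proj₂ (proj₂ d)))))
    ; β-other   = λ y y≢0 y≢c → case cover zero c j k d y of λ
        { (inj₁ e)                  → contradiction e y≢0
        ; (inj₂ (inj₁ e))           → contradiction e y≢c
        ; (inj₂ (inj₂ (inj₁ refl))) → pair?-left j k
        ; (inj₂ (inj₂ (inj₂ refl))) → pair?-right j k }
    }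
    where
    cancel : ∀ s t → s xor (s xor t) ≡ t
    cancel false t = refl
    cancel true  t = Bool.not-involutive t

switch⇒separation : ∀ {n} {f g : Vec A (suc n) → A} → LineInjective f → LineInjective g → f ≈₀ g →
  ∀ {c} → c ≢ zero → (∀ x → f (c ∷ x) ≡ g (c ∷ x)) → ∀ x → f x ≢ g x → Separation f c
switch⇒separation f-inj g-inj f≈g {c} c≢0 same (j ∷ p) differ
  with fourth zero c j (≢-sym c≢0 , 0≢j , c≢j)
  where
  0≢j : zero ≢ j
  0≢j refl = differ (f≈g (zero ∷ p) (zero , refl))
  c≢j : c ≢ j
  c≢j refl = differ (same p)
... | k , d = Switch.separation f-inj g-inj f≈g d same p differ

-- A as the Klein four-group: binary digits are added without carry.

fromBits : Bool → Bool → A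
fromBits false false = 0F
fromBits false true  = 1F
fromBits true  false = 2F
fromBits true  true  = 3F

high low : A → Bool
high 0F = false
high 1F = false
high 2F = true
high 3F = true
low 0F = false
low 1F = true
low 2F = false
low 3F = true

infixr 6 _⊕_
_⊕_ : A → A → A
a ⊕ b = fromBits (high a xor high b) (low a xor low b)

fromBits-⊕ : ∀ s t s′ t′ → fromBits s t ⊕ fromBits s′ t′ ≡ fromBits (s xor s′) (t xor t′)
fromBits-⊕ s t s′ t′ = cong₂ fromBits
  (cong₂ _xor_ (high-fromBits s t) (high-fromBits s′ t′))
  (cong₂ _xor_ (low-fromBits s t) (low-fromBits s′ t′))
  where
  high-fromBits : ∀ s t → high (fromBits s t) ≡ s
  high-fromBits false false = refl
  high-fromBits false true  = refl
  high-fromBits true  false = refl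
  high-fromBits true  true  = refl
  low-fromBits : ∀ s t → low (fromBits s t) ≡ t
  low-fromBits false false = refl
  low-fromBits false true  = refl
  low-fromBits true  false = refl
  low-fromBits true  true  = refl

abstract
  ⊕-assoc : ∀ a b c → (a ⊕ b) ⊕ c ≡ a ⊕ (b ⊕ c)
  ⊕-assoc = from-yes (Fin.all? λ a → Fin.all? λ b → Fin.all? λ c → ((a ⊕ b) ⊕ c) Fin.≟ (a ⊕ (b ⊕ c)))

  ⊕-comm : ∀ a b → a ⊕ b ≡ b ⊕ a
  ⊕-comm = from-yes (Fin.all? λ a → Fin.all? λ b → (a ⊕ b) Fin.≟ (b ⊕ a))

  ⊕-identityˡ : ∀ a → 0F ⊕ a ≡ a
  ⊕-identityˡ = from-yes (Fin.all? λ a → (0F ⊕ a) Fin.≟ a)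

  ⊕-identityʳ : ∀ a → a ⊕ 0F ≡ a
  ⊕-identityʳ = from-yes (Fin.all? λ a → (a ⊕ 0F) Fin.≟ a)

  ⊕-self : ∀ a → a ⊕ a ≡ 0F
  ⊕-self = from-yes (Fin.all? λ a → (a ⊕ a) Fin.≟ 0F)

⊕-involutive : ∀ a b → a ⊕ a ⊕ b ≡ b
⊕-involutive a b = trans (sym (⊕-assoc a a b)) (trans (cong (_⊕ b) (⊕-self a)) (⊕-identityˡ b))

⊕-cancelˡ : ∀ a → Injective (a ⊕_)
⊕-cancelˡ a {b} {c} e = trans (sym (⊕-involutive a b)) (trans (cong (a ⊕_) e) (⊕-involutive a c))

total : ∀ {n} → Vec A n → A
total []      = 0F
total (a ∷ x) = a ⊕ total x

-- keep t a is t outside the subgroup {0 , t}, and 0 on it; accordingly keepAll t x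
-- is t if no coordinate of x lies in {0 , t}, and 0 otherwise.
keep : A → A → A
keep t a = if pair? 0F t a then 0F else t

keepAll : ∀ {n} → A → Vec A n → A
keepAll t []      = t
keepAll t (a ∷ x) = keepAll (keep t a) x

-- The sum of the coordinates, with t added on the cube (A ∖ {0 , t})ⁿ.
switchedSum : ∀ {n} → A → Vec A n → A
switchedSum t x = total x ⊕ keepAll t x

abstract
  keep-zero : ∀ a → keep 0F a ≡ 0F
  keep-zero = from-yes (Fin.all? λ a → keep 0F a Fin.≟ 0F)

  keep-idem : ∀ t a → keep (keep t a) a ≡ keep t a
  keep-idem = from-yes (Fin.all? λ t → Fin.all? λ a → keep (keep t a) a Fin.≟ keep t a)

  -- A permutation of 1 , 2 , 3 is the identity (t = 0), a transposition fixing t, which adds t to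
  -- the other two, or a 3-cycle. On a 3-cycle the difference of y and its image runs through all
  -- nonzero values and so equals c somewhere, which the inequalities exclude.
  line-switched : ∀ c s₁ s₂ s₃ → c ≢ 0F → Distinct₄ 0F s₁ s₂ s₃ →
    s₁ ≢ c ⊕ 1F → s₂ ≢ c ⊕ 2F → s₃ ≢ c ⊕ 3F →
    ∃[ t ] (s₁ ≡ 1F ⊕ keep t 1F × s₂ ≡ 2F ⊕ keep t 2F × s₃ ≡ 3F ⊕ keep t 3F)
  line-switched = from-yes (Fin.all? λ c → Fin.all? λ s₁ → Fin.all? λ s₂ → Fin.all? λ s₃ →
    c ≢? 0F →-dec distinct₄? 0F s₁ s₂ s₃ →-dec
    s₁ ≢? (c ⊕ 1F) →-dec s₂ ≢? (c ⊕ 2F) →-dec s₃ ≢? (c ⊕ 3F) →-dec Fin.any? λ t →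
    (s₁ Fin.≟ (1F ⊕ keep t 1F)) ×-dec (s₂ Fin.≟ (2F ⊕ keep t 2F)) ×-dec (s₃ Fin.≟ (3F ⊕ keep t 3F)))

  -- For t ≠ 0 the layer at t has type 0 and the two other nonzero layers have type t. This matches
  -- the recursion of `keepAll`, which passes `keep t c` on to the layer at c.
  layers-compatible : ∀ t₁ t₂ t₃ →
    (∀ y → Distinct₄ 0F (1F ⊕ keep t₁ y) (2F ⊕ keep t₂ y) (3F ⊕ keep t₃ y)) →
    ∃[ t ] (t₁ ≡ keep t 1F × t₂ ≡ keep t 2F × t₃ ≡ keep t 3F)
  layers-compatible = from-yes (Fin.all? λ t₁ → Fin.all? λ t₂ → Fin.all? λ t₃ →
    (Fin.all? λ y → distinct₄? 0F (1F ⊕ keep t₁ y) (2F ⊕ keep t₂ y) (3F ⊕ keep t₃ y)) →-dec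
    Fin.any? λ t → (t₁ Fin.≟ keep t 1F) ×-dec (t₂ Fin.≟ keep t 2F) ×-dec (t₃ Fin.≟ keep t 3F))

keepAll-zero : ∀ {n} (x : Vec A n) → keepAll 0F x ≡ 0F
keepAll-zero []      = refl
keepAll-zero (a ∷ x) = trans (cong (λ t → keepAll t x) (keep-zero a)) (keepAll-zero x)

keepAll-replicate : ∀ n t a → keepAll t (replicate (suc n) a) ≡ keep t a
keepAll-replicate zero    t a = refl
keepAll-replicate (suc n) t a = trans (keepAll-replicate n (keep t a) a) (keep-idem t a)

distinct₄-resp : ∀ {a a′ b b′ c c′ d d′} → a ≡ a′ → b ≡ b′ → c ≡ c′ → d ≡ d′ →
                 Distinct₄ a b c d → Distinct₄ a′ b′ c′ d′
distinct₄-resp refl refl refl refl d = d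

-- Extensions of the sum from the coordinate hyperplanes

module Layers {n} {f : Vec A (suc (suc n)) → A} (f-inj : LineInjective f)
  (f≈total : f ≈₀ total)
  (layer : ∀ c → c ≢ 0F → ∃[ t ] (∀ x → c ⊕ f (c ∷ x) ≡ switchedSum t x)) where

  f-layer : ∀ {c t} → (∀ x → c ⊕ f (c ∷ x) ≡ switchedSum t x) →
            ∀ x → f (c ∷ x) ≡ (c ⊕ total x) ⊕ keepAll t x
  f-layer {c} {t} e x = begin
    f (c ∷ x)                       ≡⟨ ⊕-involutive c _ ⟨
    c ⊕ c ⊕ f (c ∷ x)               ≡⟨ cong (c ⊕_) (e x) ⟩
    c ⊕ (total x ⊕ keepAll t x)     ≡⟨ ⊕-assoc c (total x) (keepAll t x) ⟨
    (c ⊕ total x) ⊕ keepAll t x     ∎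
    where open ≡-Reasoning

  f-zero : ∀ x → f (0F ∷ x) ≡ total x
  f-zero x = trans (f≈total (0F ∷ x) (zero , refl)) (⊕-identityˡ (total x))

  t₁ t₂ t₃ : A
  t₁ = proj₁ (layer 1F λ ())
  t₂ = proj₁ (layer 2F λ ())
  t₃ = proj₁ (layer 3F λ ())

  -- On a nonempty constant tuple `keepAll` reduces to `keep`, so comparing the layers over these
  -- tuples alone is a finite check in every dimension.
  diagonal : A → Vec A (suc n)
  diagonal y = replicate (suc n) y

  offset : A → A → A
  offset y c = total (diagonal y) ⊕ f (c ∷ diagonal y)

  offset-inj : ∀ y → Injective (offset y)
  offset-inj y e = f-inj zero (0F ∷ diagonal y) (⊕-cancelˡ (total (diagonal y)) e)

  offset-zero : ∀ y → offset y 0F ≡ 0F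
  offset-zero y = trans (cong (total (diagonal y) ⊕_) (f-zero (diagonal y))) (⊕-self (total (diagonal y)))

  offset-layer : ∀ y {c t} → (∀ x → c ⊕ f (c ∷ x) ≡ switchedSum t x) → offset y c ≡ c ⊕ keep t y
  offset-layer y {c} {t} e = begin
    σ ⊕ f (c ∷ diagonal y)                 ≡⟨ cong (σ ⊕_) (f-layer {c} {t} e (diagonal y)) ⟩
    σ ⊕ ((c ⊕ σ) ⊕ keepAll t (diagonal y)) ≡⟨ cong (λ z → σ ⊕ (z ⊕ keepAll t (diagonal y))) (⊕-comm c σ) ⟩
    σ ⊕ ((σ ⊕ c) ⊕ keepAll t (diagonal y)) ≡⟨ cong (σ ⊕_) (⊕-assoc σ c _) ⟩
    σ ⊕ σ ⊕ c ⊕ keepAll t (diagonal y)     ≡⟨ ⊕-involutive σ _ ⟩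
    c ⊕ keepAll t (diagonal y)             ≡⟨ cong (c ⊕_) (keepAll-replicate n t y) ⟩
    c ⊕ keep t y                           ∎
    where
    open ≡-Reasoning
    σ : A
    σ = total (diagonal y)

  distinct : ∀ y → Distinct₄ 0F (1F ⊕ keep t₁ y) (2F ⊕ keep t₂ y) (3F ⊕ keep t₃ y)
  distinct y = distinct₄-resp
    (offset-zero y) (offset-layer y {1F} {t₁} (proj₂ (layer 1F λ ())))
    (offset-layer y {2F} {t₂} (proj₂ (layer 2F λ ()))) (offset-layer y {3F} {t₃} (proj₂ (layer 3F λ ())))
    (image-distinct₄ {offset y} (offset-inj y) (from-yes (distinct₄? 0F 1F 2F 3F)))

  switched : ∃[ t ] f ≗ switchedSum t
  switched with layers-compatible t₁ t₂ t₃ distinct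
  ... | t , e₁ , e₂ , e₃ = t , λ where
    (0F ∷ x) → trans (f≈total (0F ∷ x) (zero , refl))
      (sym (trans (cong ((0F ⊕ total x) ⊕_) (keepAll-zero x))
        (⊕-identityʳ _)))
    (1F ∷ x) → trans (f-layer {1F} {t₁} (proj₂ (layer 1F λ ())) x) (cong (λ t → (1F ⊕ total x) ⊕ keepAll t x) e₁)
    (2F ∷ x) → trans (f-layer {2F} {t₂} (proj₂ (layer 2F λ ())) x) (cong (λ t → (2F ⊕ total x) ⊕ keepAll t x) e₂)
    (3F ∷ x) → trans (f-layer {3F} {t₃} (proj₂ (layer 3F λ ())) x) (cong (λ t → (3F ⊕ total x) ⊕ keepAll t x) e₃)

-- Induction on the dimension: c ⊕ f (c ∷ x) again extends the sum, so each nonzero layer is a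
-- switched sum, and injectivity in the head direction makes the layers compatible. In dimension two
-- a layer is a line, whose value at 0 says too little; there the comparison with row 0 (`avoid`)
-- takes the place of the induction.
extends-total⇒switched : ∀ {n} {f : Vec A (suc (suc n)) → A} → LineInjective f → f ≈₀ total →
                         ∃[ t ] f ≗ switchedSum t
extends-total⇒switched {zero} {f} f-inj f≈total = Layers.switched f-inj f≈total layer
  where
  layer : ∀ c → c ≢ 0F → ∃[ t ] (∀ x → c ⊕ f (c ∷ x) ≡ switchedSum t x)
  layer c c≢0 = sol (line-switched c (s 1F) (s 2F) (s 3F) c≢0
    (distinct₄-resp s-zero refl refl refl
      (image-distinct₄ {s} s-inj (from-yes (distinct₄? 0F 1F 2F 3F))))
    (avoid 1F) (avoid 2F) (avoid 3F))
    where
    s : A → A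
    s y = c ⊕ f (c ∷ y ∷ [])
    s-inj : Injective s
    s-inj e = f-inj (suc zero) (c ∷ 0F ∷ []) (⊕-cancelˡ c e)
    s-zero : s 0F ≡ 0F
    s-zero = trans (cong (c ⊕_) (trans (f≈total (c ∷ 0F ∷ []) (suc zero , refl)) (⊕-identityʳ c))) (⊕-self c)
    avoid : ∀ y → s y ≢ c ⊕ y
    avoid y e = c≢0 (f-inj zero (c ∷ y ∷ []) (trans (⊕-cancelˡ c e)
      (sym (trans (f≈total (0F ∷ y ∷ []) (zero , refl)) (trans (⊕-identityˡ _) (⊕-identityʳ y))))))
    sol : ∃[ t ] (s 1F ≡ 1F ⊕ keep t 1F × s 2F ≡ 2F ⊕ keep t 2F × s 3F ≡ 3F ⊕ keep t 3F) →
          ∃[ t ] (∀ x → c ⊕ f (c ∷ x) ≡ switchedSum t x)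
    sol (t , e₁ , e₂ , e₃) = t , λ where
      (0F ∷ []) → s-zero
      (1F ∷ []) → e₁
      (2F ∷ []) → e₂
      (3F ∷ []) → e₃
extends-total⇒switched {suc n} {f} f-inj f≈total = Layers.switched f-inj f≈total λ c _ →
  extends-total⇒switched {f = λ x → c ⊕ f (c ∷ x)}
    (λ i x e → f-inj (suc i) (c ∷ x) (⊕-cancelˡ c e))
    λ x (i , z) → trans (cong (c ⊕_) (f≈total (c ∷ x) (suc i , z))) (⊕-involutive c (total x))

-- Isotopy

transform : ∀ {n} → (Fin n → A → A) → Vec A n → Vec A n
transform Φ []      = []
transform Φ (a ∷ x) = Φ zero a ∷ transform (Φ ∘ suc) x

transform-update : ∀ {n} (Φ : Fin n → A → A) i x {a} →
                   transform Φ (x [ i ]≔ a) ≡ transform Φ x [ i ]≔ Φ i a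
transform-update Φ zero    (_ ∷ x) = refl
transform-update Φ (suc i) (b ∷ x) = cong (Φ zero b ∷_) (transform-update (Φ ∘ suc) i x)

lookup-transform : ∀ {n} (Φ : Fin n → A → A) x i → lookup (transform Φ x) i ≡ Φ i (lookup x i)
lookup-transform Φ (a ∷ x) zero    = refl
lookup-transform Φ (a ∷ x) (suc i) = lookup-transform (Φ ∘ suc) x i

transform-inverse : ∀ {n} {Φ Ψ : Fin n → A → A} → (∀ i a → Φ i (Ψ i a) ≡ a) →
                    ∀ x → transform Φ (transform Ψ x) ≡ x
transform-inverse inv []      = refl
transform-inverse inv (a ∷ x) = cong₂ _∷_ (inv zero a) (transform-inverse (inv ∘ suc) x)

total-transform-zero : ∀ {n} {Φ : Fin n → A → A} → (∀ i → Φ i 0F ≡ 0F) →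
                       total (transform Φ (replicate n 0F)) ≡ 0F
total-transform-zero {zero}  Φ0 = refl
total-transform-zero {suc n} Φ0 = cong₂ _⊕_ (Φ0 zero) (total-transform-zero (Φ0 ∘ suc))

axis : ∀ {n} → Fin n → A → Vec A n
axis i a = replicate _ 0F [ i ]≔ a

total-transform-axis : ∀ {n} {Φ : Fin n → A → A} → (∀ i → Φ i 0F ≡ 0F) →
                       ∀ i a → total (transform Φ (axis i a)) ≡ Φ i a
total-transform-axis {Φ = Φ} Φ0 zero    a =
  trans (cong (Φ zero a ⊕_) (total-transform-zero (Φ0 ∘ suc))) (⊕-identityʳ (Φ zero a))
total-transform-axis {Φ = Φ} Φ0 (suc i) a =
  trans (cong₂ _⊕_ (Φ0 zero) (total-transform-axis (Φ0 ∘ suc) i a)) (⊕-identityˡ (Φ (suc i) a))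

-- In dimension at least two the axes lie in the coordinate hyperplanes, so the common boundary
-- values determine everything on them.
axis-hasZero : ∀ {n} (i : Fin (suc (suc n))) a → HasZero (axis i a)
axis-hasZero zero    a = suc zero , refl
axis-hasZero (suc i) a = zero , refl

parity-fromBits : ∀ {n} (β γ : Fin n → A → Bool) x →
                  fromBits (parity β x) (parity γ x) ≡
                  total (transform (λ i a → fromBits (β i a) (γ i a)) x)
parity-fromBits β γ []      = refl
parity-fromBits β γ (a ∷ x) = trans
  (sym (fromBits-⊕ (β zero a) (γ zero a) (parity (β ∘ suc) x) (parity (γ ∘ suc) x)))
  (cong (fromBits (β zero a) (γ zero a) ⊕_) (parity-fromBits (β ∘ suc) (γ ∘ suc) x))

inverse : ∀ {s} → Injective s → A → A
inverse inj = proj₁ ∘ injective⇒surjective inj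

inverseʳ : ∀ {s} (inj : Injective s) a → s (inverse inj a) ≡ a
inverseʳ inj = proj₂ ∘ injective⇒surjective inj

Coincidence : ∀ {n} → (Fin 5 → Vec A n → A) → Set
Coincidence F = ∃[ i ] ∃[ j ] (i ≢ j × F i ≗ F j)

pigeonhole : (s : Fin 5 → A) → ∃[ i ] ∃[ j ] (i ≢ j × s i ≡ s j)
pigeonhole s with Fin.pigeonhole (s≤s (s≤s (s≤s (s≤s (s≤s z≤n))))) s
... | i , j , i<j , e = i , j , Fin.<⇒≢ i<j , e

-- The two separations are the two binary digits of an isotopy that carries the common
-- values of all F i on the coordinate hyperplanes to those of total.
module TwoSeparations {n} (F : Fin 5 → Vec A (suc (suc n)) → A)
  (F-inj : ∀ i → LineInjective (F i)) (F≈F : ∀ i j → F i ≈₀ F j)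
  (i₁ i₂ : Fin 5) (S₁ : Separation (F i₁) 1F) (S₂ : Separation (F i₂) 2F) where

  module S₁ = Separation S₁
  module S₂ = Separation S₂

  ψ : A → A
  ψ v = fromBits (S₁.χ v) (S₂.χ v)

  Φ : Fin (suc (suc n)) → A → A
  Φ i a = fromBits (S₁.β i a) (S₂.β i a)

  -- The separations concern `F i₁` and `F i₂`, but at a point with a zero coordinate all `F i`
  -- share their value.
  ψ-F : ∀ i x → HasZero x → ψ (F i x) ≡ total (transform Φ x)
  ψ-F i x z = trans
    (cong₂ fromBits (trans (cong S₁.χ (F≈F i i₁ x z)) (S₁.separates x))
                    (trans (cong S₂.χ (F≈F i i₂ x z)) (S₂.separates x)))
    (parity-fromBits S₁.β S₂.β x)

  Φ-zero : ∀ i → Φ i 0F ≡ 0F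
  Φ-zero i = cong₂ fromBits (S₁.β-zero i) (S₂.β-zero i)

  -- The reason for choosing the layers 1 and 2: the high digit vanishes exactly on {0 , 1}, the low
  -- digit exactly on {0 , 2}.
  Φ₀-id : ∀ a → Φ zero a ≡ a
  Φ₀-id 0F = Φ-zero zero
  Φ₀-id 1F = cong₂ fromBits S₁.β-c (S₂.β-other 1F (λ ()) (λ ()))
  Φ₀-id 2F = cong₂ fromBits (S₁.β-other 2F (λ ()) (λ ())) S₂.β-c
  Φ₀-id 3F = cong₂ fromBits (S₁.β-other 3F (λ ()) (λ ())) (S₂.β-other 3F (λ ()) (λ ()))

  ψ-axis : ∀ i a → ψ (F i₁ (axis i a)) ≡ Φ i a
  ψ-axis i a = trans (ψ-F i₁ (axis i a) (axis-hasZero i a)) (total-transform-axis Φ-zero i a)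

  on-axis-inj : ∀ i → Injective (λ a → F i₁ (axis i a))
  on-axis-inj i = F-inj i₁ i (replicate _ 0F)

  -- Along the head axis `F i₁` is a bijection, and `ψ` after it is `Φ zero`, the identity.
  -- Injectivity of `ψ` then yields that of every `Φ i` along the other axes.
  ψ-inj : Injective ψ
  ψ-inj {a} {b} e
    with injective⇒surjective (on-axis-inj zero) a | injective⇒surjective (on-axis-inj zero) b
  ... | y , refl | z , refl = cong (λ y → F i₁ (axis zero y))
    (trans (sym (ψ-axis₀ y)) (trans e (ψ-axis₀ z)))
    where
    ψ-axis₀ : ∀ y → ψ (F i₁ (axis zero y)) ≡ y
    ψ-axis₀ y = trans (ψ-axis zero y) (Φ₀-id y)

  Φ-inj : ∀ i → Injective (Φ i)
  Φ-inj i {a} {b} e = on-axis-inj i (ψ-inj (trans (ψ-axis i a) (trans e (sym (ψ-axis i b)))))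

  Φ⁻¹ : Fin (suc (suc n)) → A → A
  Φ⁻¹ i = inverse (Φ-inj i)

  Φ∘Φ⁻¹ : ∀ i a → Φ i (Φ⁻¹ i a) ≡ a
  Φ∘Φ⁻¹ i = inverseʳ (Φ-inj i)

  Φ⁻¹∘Φ : ∀ i a → Φ⁻¹ i (Φ i a) ≡ a
  Φ⁻¹∘Φ i a = Φ-inj i (Φ∘Φ⁻¹ i (Φ i a))

  G : Fin 5 → Vec A (suc (suc n)) → A
  G i x = ψ (F i (transform Φ⁻¹ x))

  G-inj : ∀ i → LineInjective (G i)
  G-inj i j x {a} {b} e = trans (sym (Φ∘Φ⁻¹ j a)) (trans (cong (Φ j) Φ⁻¹a≡Φ⁻¹b) (Φ∘Φ⁻¹ j b))
    where
    Φ⁻¹a≡Φ⁻¹b : Φ⁻¹ j a ≡ Φ⁻¹ j b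
    Φ⁻¹a≡Φ⁻¹b = F-inj i j (transform Φ⁻¹ x) (trans (cong (F i) (sym (transform-update Φ⁻¹ j x)))
      (trans (ψ-inj e) (cong (F i) (transform-update Φ⁻¹ j x))))

  G≈total : ∀ i → G i ≈₀ total
  G≈total i x (j , z) = trans
    (ψ-F i (transform Φ⁻¹ x) (j , trans (lookup-transform Φ⁻¹ x j)
      (trans (cong (Φ⁻¹ j) z) (trans (cong (Φ⁻¹ j) (sym (Φ-zero j))) (Φ⁻¹∘Φ j 0F)))))
    (cong total (transform-inverse Φ∘Φ⁻¹ x))

  type : ∀ i → ∃[ t ] G i ≗ switchedSum t
  type i = extends-total⇒switched (G-inj i) (G≈total i)

  sameType⇒≗ : ∀ i j → proj₁ (type i) ≡ proj₁ (type j) → F i ≗ F j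
  sameType⇒≗ i j e x = subst (λ y → F i y ≡ F j y) (transform-inverse Φ⁻¹∘Φ x)
    (ψ-inj (trans (proj₂ (type i) y) (trans (cong (λ t → switchedSum t y) e) (sym (proj₂ (type j) y)))))
    where
    y : Vec A (suc (suc n))
    y = transform Φ x

  coincidence : Coincidence F
  coincidence = map₂ (λ {i} → map₂ λ {j} (i≢j , e) → i≢j , sameType⇒≗ i j e) (pigeonhole (proj₁ ∘ type))

-- At most four extensions from the coordinate hyperplanes

≗-or-differ : ∀ {n} (f g : Vec A n → A) → f ≗ g ⊎ ∃[ x ] f x ≢ g x
≗-or-differ {zero} f g with f [] Fin.≟ g []
... | yes e = inj₁ λ { [] → e }
... | no ne = inj₂ ([] , ne)
≗-or-differ {suc n} f g with
    ≗-or-differ (f ∘ (0F ∷_)) (g ∘ (0F ∷_)) | ≗-or-differ (f ∘ (1F ∷_)) (g ∘ (1F ∷_))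
  | ≗-or-differ (f ∘ (2F ∷_)) (g ∘ (2F ∷_)) | ≗-or-differ (f ∘ (3F ∷_)) (g ∘ (3F ∷_))
... | inj₂ (x , ne) | _ | _ | _ = inj₂ (0F ∷ x , ne)
... | _ | inj₂ (x , ne) | _ | _ = inj₂ (1F ∷ x , ne)
... | _ | _ | inj₂ (x , ne) | _ = inj₂ (2F ∷ x , ne)
... | _ | _ | _ | inj₂ (x , ne) = inj₂ (3F ∷ x , ne)
... | inj₁ e₀ | inj₁ e₁ | inj₁ e₂ | inj₁ e₃ = inj₁ λ where
  (0F ∷ x) → e₀ x
  (1F ∷ x) → e₁ x
  (2F ∷ x) → e₂ x
  (3F ∷ x) → e₃ x

-- Otherwise s and t exchange their values at the other two places y , z. Then `ρ y` and `ρ z` both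
-- avoid these two values, and they avoid `s 0F`, which is `ρ k`; so both equal `s k`, against
-- injectivity of ρ.
module Avoiding {ρ s t : A → A} (ρ-inj : Injective ρ) (s-inj : Injective s) (t-inj : Injective t)
  (s≢ρ : ∀ y → s y ≢ ρ y) (t≢ρ : ∀ y → t y ≢ ρ y) {k} (ρk≡s0 : ρ k ≡ s 0F)
  (e₀ : s 0F ≡ t 0F) (eₖ : s k ≡ t k) where

  determined : s ≗ t
  determined a with otherTwo 0F k (λ { refl → s≢ρ 0F (sym ρk≡s0) })
  ... | y , z , d@(_ , _ , _ , ky , kz , yz) with s y Fin.≟ t y
  ... | no sy≢ty = contradiction
    (ρ-inj (trans (only y ky (s≢ρ y) λ e → t≢ρ y (trans M.ty≡sz e))
            (sym (only z kz (λ e → t≢ρ z (trans M.tz≡sy e)) (s≢ρ z))))) yz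
    where
    module M where
      ty≡sz : t y ≡ s z
      ty≡sz = AgreeTwice.swapped s-inj t-inj d e₀ eₖ sy≢ty
      tz≡sy : t z ≡ s y
      tz≡sy = AgreeTwice.swapped s-inj t-inj (swapLast d) e₀ eₖ
        λ e → sy≢ty (AgreeTwice.agreeThrice s-inj t-inj (swapLast d) e₀ eₖ e)
    only : ∀ b → k ≢ b → s y ≢ ρ b → s z ≢ ρ b → ρ b ≡ s k
    only b k≢b ne ne′ with cover (s 0F) (s k) (s y) (s z) (image-distinct₄ {s} s-inj d) (ρ b)
    ... | inj₁ e               = contradiction (ρ-inj (trans ρk≡s0 (sym e))) k≢b
    ... | inj₂ (inj₁ e)        = e
    ... | inj₂ (inj₂ (inj₁ e)) = contradiction (sym e) ne
    ... | inj₂ (inj₂ (inj₂ e)) = contradiction (sym e) ne′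
  ... | yes sy≡ty with cover 0F k y z d a
  ... | inj₁ refl               = e₀
  ... | inj₂ (inj₁ refl)        = eₖ
  ... | inj₂ (inj₂ (inj₁ refl)) = sy≡ty
  ... | inj₂ (inj₂ (inj₂ refl)) = AgreeTwice.agreeThrice s-inj t-inj d e₀ eₖ sy≡ty

FewExtensions : ℕ → Set
FewExtensions n = (F : Fin 5 → Vec A n → A) → (∀ i → LineInjective (F i)) →
                  (∀ i j → F i ≈₀ F j) → Coincidence F

-- A line alone has six extensions of its value at 0. Here `k` is the place where row 0 takes the
-- value that row `c` has at 0; by `Avoiding` the value of row `c` at `k` fixes the row, and five
-- rows have only four such values.
row-coincidence : (F : Fin 5 → Vec A 2 → A) → (∀ i → LineInjective (F i)) → (∀ i j → F i ≈₀ F j) →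
                  ∀ c → c ≢ 0F → Coincidence (λ i x → F i (c ∷ x))
row-coincidence F F-inj F≈F c c≢0
  with injective⇒surjective (F-inj 0F (suc zero) (0F ∷ 0F ∷ [])) (F 0F (c ∷ 0F ∷ []))
... | k , ρk with pigeonhole (λ i → F i (c ∷ k ∷ []))
... | i , j , i≢j , eₖ = i , j , i≢j , λ { (y ∷ []) → determined y }
  where
  row : Fin 5 → A → A → A
  row i a y = F i (a ∷ y ∷ [])
  avoids : ∀ i y → row i c y ≢ row 0F 0F y
  avoids i y e = c≢0 (F-inj i zero (c ∷ y ∷ []) (trans e (F≈F 0F i (0F ∷ y ∷ []) (zero , refl))))
  at-zero : ∀ i j → row i c 0F ≡ row j c 0F
  at-zero i j = F≈F i j (c ∷ 0F ∷ []) (suc zero , refl)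
  row-inj : ∀ i a → Injective (row i a)
  row-inj i a = F-inj i (suc zero) (a ∷ 0F ∷ [])
  open Avoiding (row-inj 0F 0F) (row-inj i c) (row-inj j c) (avoids i) (avoids j)
    (trans ρk (at-zero 0F i)) (at-zero i j) eₖ

module _ {n} (F : Fin 5 → Vec A (suc (suc n)) → A) (F-inj : ∀ i → LineInjective (F i))
  (F≈F : ∀ i j → F i ≈₀ F j)
  (layer : ∀ c → c ≢ 0F → Coincidence (λ i x → F i (c ∷ x))) where

  coincidence-or-separation : ∀ c → c ≢ 0F → Coincidence F ⊎ ∃[ i ] Separation (F i) c
  coincidence-or-separation c c≢0 with layer c c≢0
  ... | i , j , i≢j , same with ≗-or-differ (F i) (F j)
  ... | inj₁ e            = inj₁ (i , j , i≢j , e)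
  ... | inj₂ (x , differ) =
    inj₂ (i , switch⇒separation (F-inj i) (F-inj j) (F≈F i j) c≢0 same x differ)

  layers⇒coincidence : Coincidence F
  layers⇒coincidence
    with coincidence-or-separation 1F (λ ()) | coincidence-or-separation 2F (λ ())
  ... | inj₁ e        | _             = e
  ... | inj₂ _        | inj₁ e        = e
  ... | inj₂ (i , S₁) | inj₂ (j , S₂) = TwoSeparations.coincidence F F-inj F≈F i j S₁ S₂

fewExtensions : ∀ n → FewExtensions (suc (suc n))
fewExtensions zero    F F-inj F≈F =
  layers⇒coincidence F F-inj F≈F (row-coincidence F F-inj F≈F)
fewExtensions (suc n) F F-inj F≈F = layers⇒coincidence F F-inj F≈F λ c _ →
  fewExtensions n (λ i x → F i (c ∷ x)) (λ i j x → F-inj i (suc j) (c ∷ x))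
    (λ i j → ≈₀-layer (F≈F i j) c)

-- Codes

colouring : ∀ {k} N {_~_ : Fin N → Fin N → Set} → IsDecEquivalence _~_ →
            (∀ (s : Fin (suc k) → Fin N) → (∀ i j → s i ~ s j) → ∃[ i ] ∃[ j ] (i ≢ j × s i ≡ s j)) →
            Σ[ colour ∈ (Fin N → Fin k) ] (∀ i j → i ~ j → colour i ≡ colour j → i ≡ j)
colouring zero _ _ = (λ ()) , λ ()
colouring {k} (suc N) {_~_} dec few = extend (Fin.all? used?)
  where
  module E = IsDecEquivalence dec

  rest : Σ[ colour ∈ (Fin N → Fin k) ] (∀ i j → suc i ~ suc j → colour i ≡ colour j → i ≡ j)
  rest = colouring N (On.isDecEquivalence suc dec) λ s s~s →
    map₂ (map₂ (map₂ Fin.suc-injective)) (few (suc ∘ s) s~s)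

  colour : Fin N → Fin k
  colour = proj₁ rest

  Used : Fin k → Set
  Used c = ∃[ j ] (suc j ~ zero × colour j ≡ c)

  used? : ∀ c → Dec (Used c)
  used? c = Fin.any? λ j → (suc j E.≟ zero) ×-dec (colour j Fin.≟ c)

  extend : Dec (∀ c → Used c) →
           Σ[ colour ∈ (Fin (suc N) → Fin k) ] (∀ i j → i ~ j → colour i ≡ colour j → i ≡ j)
  extend (yes used) = contradiction (few s λ i j → E.trans (s~0 i) (E.sym (s~0 j)))
    λ (i , j , i≢j , e) → i≢j (s-inj i j e)
    where
    s : Fin (suc k) → Fin (suc N)
    s zero    = zero
    s (suc c) = suc (proj₁ (used c))
    s~0 : ∀ i → s i ~ zero
    s~0 zero    = E.refl
    s~0 (suc c) = proj₁ (proj₂ (used c))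
    s-inj : ∀ i j → s i ≡ s j → i ≡ j
    s-inj zero    zero    _ = refl
    s-inj (suc c) (suc d) e = cong suc (trans (sym (proj₂ (proj₂ (used c))))
      (trans (cong colour (Fin.suc-injective e)) (proj₂ (proj₂ (used d)))))
  extend (no ¬used) with Fin.¬∀⟶∃¬ k Used used? ¬used
  ... | c , unused = colour′ , proper
    where
    colour′ : Fin (suc N) → Fin k
    colour′ zero    = c
    colour′ (suc j) = colour j
    proper : ∀ i j → i ~ j → colour′ i ≡ colour′ j → i ≡ j
    proper zero    zero    _ _ = refl
    proper zero    (suc j) r e = contradiction (j , E.sym r , sym e) unused
    proper (suc i) zero    r e = contradiction (i , r , e) unused
    proper (suc i) (suc j) r e = cong suc (proj₂ rest i j r e)

-- Only quasigroups with equal boundary values need different codes, so `k` bounds the number of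
-- extensions of any one boundary.
record ExtensionCode (n k : ℕ) : Set where
  field
    code     : Quasigroup n → Fin k
    code-inj : ∀ p q → op p ≈₀ op q → code p ≡ code q → op p ≗ op q

open ExtensionCode

op-lineInjective : ∀ {n} (p : Quasigroup n) → LineInjective (op p)
op-lineInjective p = isQuasigroup⇒lineInjective {f = op p} (isQuasigroup p)

constantCode : ExtensionCode 0 4
constantCode = record
  { code     = λ p → op p []
  ; code-inj = λ { p q _ e [] → e }
  }

punchOut-injective′ : ∀ {n} {i i′ j j′ : Fin (suc n)} {i≢j : i ≢ j} {i′≢j′ : i′ ≢ j′} →
                      i ≡ i′ → punchOut i≢j ≡ punchOut i′≢j′ → j ≡ j′
punchOut-injective′ {i≢j = i≢j} {i′≢j′} refl e = Fin.punchOut-injective i≢j i′≢j′ e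

module _ {a b c : A} where

  rank₁ : Distinct₃ a b c → Fin 3
  rank₁ (ab , _ , _) = punchOut ab

  rank₂ : Distinct₃ a b c → Fin 2
  rank₂ (ab , ac , bc) = punchOut {i = punchOut ab} {j = punchOut ac} (bc ∘ Fin.punchOut-injective ab ac)

rank₁-inj : ∀ {a a′ b b′ c c′} (d : Distinct₃ a b c) (d′ : Distinct₃ a′ b′ c′) →
            a ≡ a′ → rank₁ d ≡ rank₁ d′ → b ≡ b′
rank₁-inj _ _ = punchOut-injective′

rank₂-inj : ∀ {a a′ b b′ c c′} (d : Distinct₃ a b c) (d′ : Distinct₃ a′ b′ c′) →
            a ≡ a′ → rank₁ d ≡ rank₁ d′ → rank₂ d ≡ rank₂ d′ → c ≡ c′
rank₂-inj _ _ a≡a′ e e′ = punchOut-injective′ a≡a′ (punchOut-injective′ e e′)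

-- A Lehmer code, 6 = 3 · 2: once the value at 0 is known, three values remain at 1 and two at 2,
-- numbered by `punchOut`, and the value at 3 is forced.
lineCode : ExtensionCode 1 6
lineCode = record
  { code     = λ p → combine (rank₁ (places p)) (rank₂ (places p))
  ; code-inj = λ { p q p≈q e (y ∷ []) → injective p q p≈q
      (Fin.combine-injective (rank₁ (places p)) (rank₂ (places p)) (rank₁ (places q)) (rank₂ (places q)) e) y }
  }
  where
  value : Quasigroup 1 → A → A
  value p y = op p (y ∷ [])

  value-inj : ∀ p → Injective (value p)
  value-inj p = op-lineInjective p zero (0F ∷ [])

  places : ∀ p → Distinct₃ (value p 0F) (value p 1F) (value p 2F)
  places p = from-yes (0F ≢? 1F) ∘ value-inj p , from-yes (0F ≢? 2F) ∘ value-inj p ,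
             from-yes (1F ≢? 2F) ∘ value-inj p

  injective : ∀ p q → op p ≈₀ op q →
              rank₁ (places p) ≡ rank₁ (places q) × rank₂ (places p) ≡ rank₂ (places q) →
              value p ≗ value q
  injective p q p≈q (e , e′) = λ
    { 0F → e₀
    ; 1F → e₁
    ; 2F → e₂
    ; 3F → AgreeTwice.agreeThrice (value-inj p) (value-inj q) {0F} {1F} {2F} {3F}
           (from-yes (distinct₄? 0F 1F 2F 3F)) e₀ e₁ e₂ }
    where
    e₀ : value p 0F ≡ value q 0F
    e₀ = p≈q (0F ∷ []) (zero , refl)
    e₁ : value p 1F ≡ value q 1F
    e₁ = rank₁-inj (places p) (places q) e₀ e
    e₂ : value p 2F ≡ value q 2F
    e₂ = rank₂-inj (places p) (places q) e₀ e e′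

≈₀-isDecEquivalence : ∀ n → IsDecEquivalence (_≈₀_ {n})
≈₀-isDecEquivalence n = record
  { isEquivalence = record
    { refl  = λ _ _ → refl
    ; sym   = λ e x z → sym (e x z)
    ; trans = λ e e′ x z → trans (e x z) (e′ x z)
    }
  ; _≟_ = λ f g → allVec? λ x →
      (Fin.any? λ i → lookup x i Fin.≟ zero) →-dec (f x Fin.≟ g x)
  }

-- The relation `_≈₀_` is transported along the enumeration to `Fin N`, where its classes can be
-- coloured with four colours.
fewExtensions⇒code : ∀ {n N} → Inverse (quasigroupSetoid n) (setoid (Fin N)) → FewExtensions n →
                     ExtensionCode n 4
fewExtensions⇒code {n} {N} enumeration few = record
  { code     = proj₁ colours ∘ to
  ; code-inj = λ p q p≈q e x → trans (sym (strictlyInverseʳ p x)) (trans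
      (cong (λ i → op (from i) x) (proj₂ colours (to p) (to q)
        (λ y z → trans (strictlyInverseʳ p y) (trans (p≈q y z) (sym (strictlyInverseʳ q y)))) e))
      (strictlyInverseʳ q x))
  }
  where
  open Inverse enumeration

  colours : Σ[ colour ∈ (Fin N → A) ] (∀ i j → op (from i) ≈₀ op (from j) → colour i ≡ colour j → i ≡ j)
  colours = colouring N (On.isDecEquivalence (op ∘ from) (≈₀-isDecEquivalence n))
    λ s s~s → map₂ (map₂ (map₂ λ e → trans (sym (strictlyInverseˡ _)) (trans (to-cong e) (strictlyInverseˡ _))))
      (few (op ∘ from ∘ s) (op-lineInjective ∘ from ∘ s) s~s)

codeCount : ℕ → ℕ
codeCount 0             = 4
codeCount 1             = 6
codeCount (suc (suc n)) = 4

extensionCode : ∀ n → ExtensionCode n (codeCount n)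
extensionCode 0             = constantCode
extensionCode 1             = lineCode
extensionCode (suc (suc n)) = fewExtensions⇒code (Q-counts (suc (suc n))) (fewExtensions n)

-- Faces of Aⁿ through the origin: S lists the free coordinates, the others are 0.

size : ∀ {n} → Vec Bool n → ℕ
size []          = 0
size (true ∷ S)  = suc (size S)
size (false ∷ S) = size S

embed : ∀ {n} (S : Vec Bool n) → Vec A (size S) → Vec A n
embed []          []      = []
embed (true ∷ S)  (a ∷ x) = a ∷ embed S x
embed (false ∷ S) x       = 0F ∷ embed S x

embed-lineInjective : ∀ {n} {f : Vec A n → A} → LineInjective f → ∀ S → LineInjective (f ∘ embed S)
embed-lineInjective         f-inj (true ∷ S)  zero    (a ∷ x) = f-inj zero (a ∷ embed S x)
embed-lineInjective {f = f} f-inj (true ∷ S)  (suc i) (a ∷ x) =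
  embed-lineInjective {f = f ∘ (a ∷_)} (λ i x → f-inj (suc i) (a ∷ x)) S i x
embed-lineInjective {f = f} f-inj (false ∷ S) i       x       =
  embed-lineInjective {f = f ∘ (0F ∷_)} (λ i x → f-inj (suc i) (0F ∷ x)) S i x

face : ∀ {n} → Quasigroup n → (S : Vec Bool n) → Quasigroup (size S)
face p S = mkQuasigroup (op p ∘ embed S)
  (lineInjective⇒isQuasigroup (embed-lineInjective {f = op p} (op-lineInjective p) S))

-- A free coordinate with value 0 can be declared fixed, which gives the same point in a face of one
-- dimension less.
smallerFace : ∀ {n} (S : Vec Bool n) x → HasZero x →
              ∃[ S′ ] ∃[ x′ ] (size S ≡ suc (size S′) × embed S x ≡ embed S′ x′)
smallerFace (true ∷ S)  (a ∷ x) (zero , refl) = false ∷ S , x , refl , refl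
smallerFace (true ∷ S)  (a ∷ x) (suc i , z) with smallerFace S x (i , z)
... | S′ , x′ , e , e′ = true ∷ S′ , a ∷ x′ , cong suc e , cong (a ∷_) e′
smallerFace (false ∷ S) x       z with smallerFace S x z
... | S′ , x′ , e , e′ = false ∷ S′ , x′ , e , cong (0F ∷_) e′

embed-surjective : ∀ {n} (y : Vec A n) → ∃[ S ] ∃[ x ] embed S x ≡ y
embed-surjective []      = [] , [] , refl
embed-surjective (a ∷ y) with embed-surjective y
... | S , x , e = true ∷ S , a ∷ x , cong (a ∷_) e

faceCode : ∀ {n} → Quasigroup n → (S : Vec Bool n) → Fin (codeCount (size S))
faceCode p S = code (extensionCode (size S)) (face p S)

faceCodes-determine : ∀ {n} (p q : Quasigroup n) → (∀ S → faceCode p S ≡ faceCode q S) → op p ≗ op q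
faceCodes-determine p q same y with embed-surjective y
... | S , x , refl = agree (size S) S refl x
  where
  -- Mutual induction on the dimension k of the face: boundary points lie in faces of dimension k -
  -- 1, and the code settles the rest of the face.
  agree       : ∀ k S → size S ≡ k → op p ∘ embed S ≗ op q ∘ embed S
  on-boundary : ∀ k S → size S ≡ k → op p ∘ embed S ≈₀ op q ∘ embed S

  agree k S e =
    code-inj (extensionCode (size S)) (face p S) (face q S) (on-boundary k S e) (same S)

  on-boundary k S e x z with smallerFace S x z
  on-boundary zero    S e x z | S′ , x′ , e′ , emb = contradiction (trans (sym e′) e) λ ()
  on-boundary (suc k) S e x z | S′ , x′ , e′ , emb = trans (cong (op p) emb)
    (trans (agree k S′ (ℕ.suc-injective (trans (sym e′) e)) x′) (cong (op q) (sym emb)))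

-- The product of c (size S) over all S.
faceProduct : (ℕ → ℕ) → ℕ → ℕ
faceProduct c zero    = c 0
faceProduct c (suc n) = faceProduct c n * faceProduct (c ∘ suc) n

combineFaces : ∀ {c} n → ((S : Vec Bool n) → Fin (c (size S))) → Fin (faceProduct c n)
combineFaces         zero    d = d []
combineFaces {c = c} (suc n) d =
  combine (combineFaces {c} n (d ∘ (false ∷_))) (combineFaces {c ∘ suc} n (d ∘ (true ∷_)))

combineFaces-injective : ∀ {c} n (d d′ : (S : Vec Bool n) → Fin (c (size S))) →
                         combineFaces {c} n d ≡ combineFaces {c} n d′ → ∀ S → d S ≡ d′ S
combineFaces-injective zero    d d′ e [] = e
combineFaces-injective {c} (suc n) d d′ e (b ∷ S)
  with Fin.combine-injective (combineFaces {c} n (d ∘ (false ∷_))) (combineFaces {c ∘ suc} n (d ∘ (true ∷_)))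
         (combineFaces {c} n (d′ ∘ (false ∷_))) (combineFaces {c ∘ suc} n (d′ ∘ (true ∷_))) e | b
... | e₀ , _  | false = combineFaces-injective {c} n (d ∘ (false ∷_)) (d′ ∘ (false ∷_)) e₀ S
... | _  , e₁ | true  = combineFaces-injective {c ∘ suc} n (d ∘ (true ∷_)) (d′ ∘ (true ∷_)) e₁ S

Q≤faceProduct : ∀ n → Q n ≤ faceProduct codeCount n
Q≤faceProduct n = Fin.injective⇒≤ {f = number} λ {i} {j} e →
  trans (sym (strictlyInverseˡ i)) (trans
    (to-cong (faceCodes-determine (from i) (from j)
      (combineFaces-injective {codeCount} n (faceCode (from i)) (faceCode (from j)) e)))
    (strictlyInverseˡ j))
  where
  open Inverse (Q-counts n)
  number : Fin (Q n) → Fin (faceProduct codeCount n)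
  number i = combineFaces {codeCount} n (faceCode (from i))

-- The bound, in a form without subtraction

bound : ℕ → ℕ
bound n = 4 * 6 ^ n * 4 ^ (2 ^ n ∸ n ∸ 1)

^-double : ∀ m n → m ^ (2 ^ suc n) ≡ m ^ (2 ^ n) * m ^ (2 ^ n)
^-double m n = trans (cong (λ k → m ^ (2 ^ n + k)) (ℕ.+-identityʳ (2 ^ n)))
  (ℕ.^-distribˡ-+-* m (2 ^ n) (2 ^ n))

faceProduct-const : ∀ n → faceProduct (λ _ → 4) n ≡ 4 ^ (2 ^ n)
faceProduct-const zero    = refl
faceProduct-const (suc n) =
  trans (cong₂ _*_ (faceProduct-const n) (faceProduct-const n)) (sym (^-double 4 n))

-- These are the faces whose head coordinate is free: one of them is a line, with factor 6, and the
-- other 2^n - 1 have factor 4.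
faceProduct-codeCount-suc : ∀ n → faceProduct (codeCount ∘ suc) n * 4 ≡ 6 * 4 ^ (2 ^ n)
faceProduct-codeCount-suc zero    = refl
faceProduct-codeCount-suc (suc n) = begin
  P * faceProduct (λ _ → 4) n * 4 ≡⟨ cong (λ k → P * k * 4) (faceProduct-const n) ⟩
  P * B * 4                       ≡⟨ solve 2 (λ P B → P :* B :* con 4 := P :* con 4 :* B) refl P B ⟩
  P * 4 * B                       ≡⟨ cong (_* B) (faceProduct-codeCount-suc n) ⟩
  6 * B * B                       ≡⟨ ℕ.*-assoc 6 B B ⟩
  6 * (B * B)                     ≡⟨ cong (6 *_) (^-double 4 n) ⟨
  6 * 4 ^ (2 ^ suc n)             ∎
  where
  open ≡-Reasoning
  P B : ℕ
  P = faceProduct (codeCount ∘ suc) n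
  B = 4 ^ (2 ^ n)

-- Of the 2^n faces, n are lines; the factor 4 ^ n on the left replaces a subtraction of n in the
-- exponent on the right.
faceProduct-codeCount : ∀ n → faceProduct codeCount n * 4 ^ n ≡ 6 ^ n * 4 ^ (2 ^ n)
faceProduct-codeCount zero    = refl
faceProduct-codeCount (suc n) = begin
  P₀ * P₁ * (4 * 4 ^ n)       ≡⟨ solve 3 (λ p q r → p :* q :* (con 4 :* r) := p :* r :* (q :* con 4))
                                   refl P₀ P₁ (4 ^ n) ⟩
  P₀ * 4 ^ n * (P₁ * 4)       ≡⟨ cong₂ _*_ (faceProduct-codeCount n) (faceProduct-codeCount-suc n) ⟩
  6 ^ n * B * (6 * B)         ≡⟨ solve 2 (λ s B → s :* B :* (con 6 :* B) := con 6 :* s :* (B :* B))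
                                   refl (6 ^ n) B ⟩
  6 * 6 ^ n * (B * B)         ≡⟨ cong (6 * 6 ^ n *_) (^-double 4 n) ⟨
  6 ^ suc n * 4 ^ (2 ^ suc n) ∎
  where
  open ≡-Reasoning
  P₀ P₁ B : ℕ
  P₀ = faceProduct codeCount n
  P₁ = faceProduct (codeCount ∘ suc) n
  B  = 4 ^ (2 ^ n)

-- Makes the truncated subtractions in `2 ^ n ∸ n ∸ 1` exact.
1+n≤2^n : ∀ n → 1 + n ≤ 2 ^ n
1+n≤2^n zero    = ℕ.≤-refl
1+n≤2^n (suc n) = ℕ.+-mono-≤ (ℕ.m^n>0 2 n) (ℕ.≤-trans (1+n≤2^n n) (ℕ.m≤m+n (2 ^ n) 0))

bound*4^n : ∀ n → bound n * 4 ^ n ≡ 6 ^ n * 4 ^ (2 ^ n)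
bound*4^n n = begin
  4 * s * 4 ^ (2 ^ n ∸ n ∸ 1) * 4 ^ n     ≡⟨ solve 3 (λ s d r → con 4 :* s :* d :* r := s :* (d :* (con 4 :* r)))
                                               refl s (4 ^ (2 ^ n ∸ n ∸ 1)) (4 ^ n) ⟩
  s * (4 ^ (2 ^ n ∸ n ∸ 1) * 4 ^ suc n)   ≡⟨ cong (s *_) (ℕ.^-distribˡ-+-* 4 (2 ^ n ∸ n ∸ 1) (suc n)) ⟨
  s * 4 ^ (2 ^ n ∸ n ∸ 1 + suc n)         ≡⟨ cong (λ k → s * 4 ^ (k + suc n)) (ℕ.∸-+-assoc (2 ^ n) n 1) ⟩
  s * 4 ^ (2 ^ n ∸ (n + 1) + suc n)       ≡⟨ cong (λ k → s * 4 ^ (2 ^ n ∸ k + suc n)) (ℕ.+-comm n 1) ⟩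
  s * 4 ^ (2 ^ n ∸ suc n + suc n)         ≡⟨ cong (λ k → s * 4 ^ k) (ℕ.m∸n+n≡m (1+n≤2^n n)) ⟩
  s * 4 ^ (2 ^ n)                         ∎
  where
  open ≡-Reasoning
  s : ℕ
  s = 6 ^ n

faceProduct≡bound : ∀ n → faceProduct codeCount n ≡ bound n
faceProduct≡bound n = ℕ.*-cancelʳ-≡ _ _ (4 ^ n) {{ℕ.m^n≢0 4 n}}
  (trans (faceProduct-codeCount n) (sym (bound*4^n n)))

-- Asymptotics of the bound

4^2^n : ∀ n → 4 ^ (2 ^ n) ≡ 2 ^ (2 ^ (n + 1))
4^2^n n = trans (ℕ.^-*-assoc 2 2 (2 ^ n)) (cong (λ k → 2 ^ (2 ^ k)) (ℕ.+-comm 1 n))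

bound-asymptotics : bound =2^⟨ (λ n → 2 ^ (n + 1)) +O⟨ (λ n → n) ⟩⟩
-- By `bound*4^n` the bound differs from 4 ^ (2 ^ n) by the factor 6 ^ n / 4 ^ n. Estimating 4 and 6
-- by 8 = 2 ^ 3 gives the constant 3 in both directions, already from n = 0 on.
bound-asymptotics = 3 , 0 , λ n _ → lower n , upper n
  where
  open ℕ.≤-Reasoning
  lower : ∀ n → 2 ^ (2 ^ (n + 1)) ≤ bound n * 2 ^ (3 * n)
  lower n = begin
    2 ^ (2 ^ (n + 1))    ≡⟨ 4^2^n n ⟨
    4 ^ (2 ^ n)          ≤⟨ ℕ.m≤n*m (4 ^ (2 ^ n)) (6 ^ n) {{ℕ.m^n≢0 6 n}} ⟩
    6 ^ n * 4 ^ (2 ^ n)  ≡⟨ bound*4^n n ⟨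
    bound n * 4 ^ n      ≤⟨ ℕ.*-monoʳ-≤ (bound n) (ℕ.^-monoˡ-≤ n (ℕ.m≤m+n 4 4)) ⟩
    bound n * 8 ^ n      ≡⟨ cong (bound n *_) (ℕ.^-*-assoc 2 3 n) ⟩
    bound n * 2 ^ (3 * n) ∎
  upper : ∀ n → bound n ≤ 2 ^ (2 ^ (n + 1) + 3 * n)
  upper n = begin
    bound n                           ≤⟨ ℕ.m≤m*n (bound n) (4 ^ n) {{ℕ.m^n≢0 4 n}} ⟩
    bound n * 4 ^ n                   ≡⟨ bound*4^n n ⟩
    6 ^ n * 4 ^ (2 ^ n)               ≡⟨ ℕ.*-comm (6 ^ n) (4 ^ (2 ^ n)) ⟩
    4 ^ (2 ^ n) * 6 ^ n               ≤⟨ ℕ.*-monoʳ-≤ (4 ^ (2 ^ n)) (ℕ.^-monoˡ-≤ n (ℕ.m≤m+n 6 2)) ⟩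
    4 ^ (2 ^ n) * 8 ^ n               ≡⟨ cong₂ _*_ (4^2^n n) (ℕ.^-*-assoc 2 3 n) ⟩
    2 ^ (2 ^ (n + 1)) * 2 ^ (3 * n)   ≡⟨ ℕ.^-distribˡ-+-* 2 (2 ^ (n + 1)) (3 * n) ⟨
    2 ^ (2 ^ (n + 1) + 3 * n)         ∎

mainTheorem4 : (∀ (n : ℕ) → n ≥ 1 → Q n ≤ 4 * 6 ^ n * 4 ^ (2 ^ n ∸ n ∸ 1))
    × ((λ n → 4 * 6 ^ n * 4 ^ (2 ^ n ∸ n ∸ 1)) =2^⟨ (λ n → 2 ^ (n + 1)) +O⟨ (λ n → n) ⟩⟩)
mainTheorem4 =
  (λ n _ → ℕ.≤-trans (Q≤faceProduct n) (ℕ.≤-reflexive (faceProduct≡bound n))) , bound-asymptotics
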